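{- For every set of sentences (closed formulas) $\Gamma\cup\{\varphi\}\subseteq Sen(\Omega)$: if $\Gamma\models_{\mathbf{RQmbC}}\varphi$ then $\Gamma\vdash_{\mathbf{RQmbC}}\varphi$.
   Context: Let $\Sigma=\{\wedge,\vee,\to,\neg,\circ\}$ ($\neg,\circ$ unary). A first-order signature $\Omega$ extending $\Sigma$ consists of $\Sigma$ together with a (possibly empty) denumerable set $\mathcal C$ of individual constants and, for each $n\ge1$, (possibly empty) denumerable sets $\mathcal F_n$, $\mathcal P_n$ of $n$-ary function and predicate symbols, with $\bigcup_n\mathcal P_n\ne\emptyset$. $Var$ is a fixed denumerable set of individual variables. Terms are built from $Var\cup\mathcal C$ by function symbols; $For_1(\Omega)$ is generated from atomic formulas $P(\tau_1,\dots,\tau_n)$ by the connectives in $\Sigma$ and the quantifiers $\forall x,\exists x$ ($x\in Var$); $Sen(\Omega)$ is the set of formulas without free variables. $\alpha\leftrightarrow\beta$ abbreviates $(\alpha\to\beta)\wedge(\beta\to\alpha)$; $\varphi[x/t]$ is the substitution of $t$ for the free occurrences of $x$. $\mathbf{RQmbC}$ is the Hilbert calculus over $For_1(\Omega)$ with axiom schemas: (Ax1) $\alpha\to(\beta\to\alpha)$; (Ax2) $(\alpha\to(\beta\to\gamma))\to((\alpha\to\beta)\to(\alpha\to\gamma))$; (Ax3) $\alpha\to(\beta\to(\alpha\wedge\beta))$; (Ax4) $(\alpha\wedge\beta)\to\alpha$; (Ax5) $(\alpha\wedge\beta)\to\beta$; (Ax6) $\alpha\to(\alpha\vee\beta)$;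 (Ax7) $\beta\to(\alpha\vee\beta)$; (Ax8) $(\alpha\to\gamma)\to((\beta\to\gamma)\to((\alpha\vee\beta)\to\gamma))$; (Ax9) $(\alpha\to\beta)\vee\alpha$; (Ax10) $\alpha\vee\neg\alpha$; (bc1) $\circ\alpha\to(\alpha\to(\neg\alpha\to\beta))$; (Ax$\exists$) $\varphi[x/t]\to\exists x\varphi$ and (Ax$\forall$) $\forall x\varphi\to\varphi[x/t]$, for $t$ a term free for $x$ in $\varphi$; and rules: (MP) from $\alpha$, $\alpha\to\beta$ infer $\beta$; $(\mathbf R_\neg)$ from $\alpha\leftrightarrow\beta$ infer $\neg\alpha\leftrightarrow\neg\beta$; $(\mathbf R_\circ)$ from $\alpha\leftrightarrow\beta$ infer $\circ\alpha\leftrightarrow\circ\beta$; ($\exists$-In) from $\varphi\to\psi$ infer $\exists x\varphi\to\psi$, if $x$ is not free in $\psi$; ($\forall$-In) from $\varphi\to\psi$ infer $\varphi\to\forall x\psi$, if $x$ is not free in $\varphi$. $\vdash_{\mathbf{RQmbC}}\varphi$ means there is a finite sequence of formulas ending in $\varphi$ each of which is an instance of an axiom schema or follows from earlier ones by a rule. $\Gamma\vdash_{\mathbf{RQmbC}}\varphi$ means that either $\vdash_{\mathbf{RQmbC}}\varphi$ or there is a finite non-empty $\{\gamma_1,\dots,\gamma_n\}\subseteq\Gamma$ with $\vdash_{\mathbf{RQmbC}}(\gamma_1\wedge(\cdots\wedge(\gamma_{n-1}\wedge\gamma_n)\cdots))\to\varphi$. A BALFI is an algebra $\mathcal B=\langle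 A,\wedge,\vee,\to,\neg,\circ,0,1\rangle$ such that $\langle A,\wedge,\vee,\to,0,1\rangle$ is a Boolean algebra (with $\to$ the Boolean implication) and $a\vee\neg a=1$, $a\wedge\neg a\wedge\circ a=0$ for all $a\in A$; it is complete if its Boolean reduct is complete. A structure over $\Omega$ is $\mathfrak A=\langle U,\mathcal B,I_{\mathfrak A}\rangle$ with $U\neq\emptyset$, $\mathcal B$ a complete BALFI with carrier $A$, and $I_{\mathfrak A}$ interpreting each constant $c$ as $c^{\mathfrak A}\in U$, each $n$-ary function symbol $f$ as $f^{\mathfrak A}:U^n\to U$, each $n$-ary predicate symbol $P$ as $P^{\mathfrak A}:U^n\to A$. An assignment is $\mu:Var\to U$; $\mu^x_a$ agrees with $\mu$ except $\mu^x_a(x)=a$. Terms are interpreted as usual by $[\![t]\!]^{\mathfrak A}_\mu\in U$. Formulas are interpreted in $A$ by: $[\![P(t_1,\dots,t_n)]\!]_\mu=P^{\mathfrak A}([\![t_1]\!]_\mu,\dots,[\![t_n]\!]_\mu)$; $[\![\#\varphi]\!]_\mu=\#[\![\varphi]\!]_\mu$ for $\#\in\{\neg,\circ\}$; $[\![\varphi\#\psi]\!]_\mu=[\![\varphi]\!]_\mu\#[\![\psi]\!]_\mu$ for $\#\in\{\wedge,\vee,\to\}$; $[\![\forall x\varphi]\!]_\mu=\bigwedge_{a\in U}[\![\varphi]\!]_{\mu^x_a}$; $[\![\exists x\varphi]\!]_\mu=\bigvee_{a\in U}[\![\varphi]\!]_{\mu^x_a}$. $\models_{\mathbf{RQmbC}}\varphi$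 means $[\![\varphi]\!]^{\mathfrak A}_\mu=1$ for every structure $\mathfrak A$ over $\Omega$ and every assignment $\mu$. $\Gamma\models_{\mathbf{RQmbC}}\varphi$ means that either $\models_{\mathbf{RQmbC}}\varphi$ or there is a finite non-empty $\{\gamma_1,\dots,\gamma_n\}\subseteq\Gamma$ with $\models_{\mathbf{RQmbC}}(\gamma_1\wedge\cdots\wedge\gamma_n)\to\varphi$. -}

module Defs where

open import Algebra.Core using (Op₁; Op₂)
open import Algebra.Lattice.Bundles using (BooleanAlgebra)
import Algebra.Lattice.Properties.Lattice as LatticeProperties
open import Data.List.Base using (List; []; _∷_)
open import Data.List.Membership.Propositional using () renaming (_∈_ to _∈ˡ_)
open import Data.List.NonEmpty.Base using (List⁺; toList; foldr₁)
open import Data.List.Relation.Unary.All using (All)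
open import Data.Nat.Base using (ℕ; suc)
open import Data.Nat.Properties using (_≟_)
open import Data.Product.Base using (Σ; ∃; ∃-syntax; _×_; _,_; proj₁)
open import Data.Sum.Base using (_⊎_)
open import Data.Unit.Base using (⊤)
open import Data.Vec.Base using (Vec; []; _∷_)
open import Function.Base using (_∘_)
open import Function.Bundles using (_↣_)
open import Level using (Level; _⊔_) renaming (suc to lsuc)
open import Relation.Binary.Bundles using (Poset)
open import Relation.Binary.PropositionalEquality.Core using (_≡_; _≢_)
open import Relation.Nullary.Decidable.Core using (yes; no)
open import Relation.Nullary.Negation.Core using (¬_)
open import Relation.Unary using (Pred; _∈_)

------------------------------------------------------------------------
-- Syntax

-- Function and predicate symbols have positive arity: Fun n and Pre n are
-- the symbols of arity suc n.  "Denumerable" allows finite and empty sets,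
-- so it is rendered as the existence of an injection into ℕ.
record Signature : Set₁ where
  field
    Con : Set
    Fun : ℕ → Set
    Pre : ℕ → Set
    Con-countable : Con ↣ ℕ
    Fun-countable : ∀ n → Fun n ↣ ℕ
    Pre-countable : ∀ n → Pre n ↣ ℕ
    Pre-nonempty  : ∃[ n ] Pre n

open Signature public

Var : Set
Var = ℕ

data Term (Ω : Signature) : Set where
  var : Var → Term Ω
  con : Con Ω → Term Ω
  fun : ∀ {n} → Fun Ω n → Vec (Term Ω) (suc n) → Term Ω

infixr 7 _∧ᶠ_
infixr 6 _∨ᶠ_
infixr 5 _→ᶠ_
infix  4 _↔ᶠ_
infix  8 ¬ᶠ_ ∘ᶠ_

data For (Ω : Signature) : Set where
  pre            : ∀ {n} → Pre Ω n → Vec (Term Ω) (suc n) → For Ω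
  _∧ᶠ_ _∨ᶠ_ _→ᶠ_ : For Ω → For Ω → For Ω
  ¬ᶠ_ ∘ᶠ_        : For Ω → For Ω
  ∀ᶠ ∃ᶠ          : Var → For Ω → For Ω

variable
  Ω : Signature

_↔ᶠ_ : For Ω → For Ω → For Ω
α ↔ᶠ β = (α →ᶠ β) ∧ᶠ (β →ᶠ α)

data OccursIn {Ω : Signature} (x : Var) : Term Ω → Set
data OccursInVec {Ω : Signature} (x : Var) : ∀ {n} → Vec (Term Ω) n → Set

data OccursIn {Ω} x where
  var : OccursIn x (var x)
  fun : ∀ {n} {f : Fun Ω n} {ts} → OccursInVec x ts → OccursIn x (fun f ts)

data OccursInVec {Ω} x where
  here  : ∀ {n} {t} {ts : Vec (Term Ω) n} → OccursIn x t → OccursInVec x (t ∷ ts)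
  there : ∀ {n} {t} {ts : Vec (Term Ω) n} → OccursInVec x ts → OccursInVec x (t ∷ ts)

FreeIn : Var → For Ω → Set
FreeIn x (pre P ts) = OccursInVec x ts
FreeIn x (φ ∧ᶠ ψ)   = FreeIn x φ ⊎ FreeIn x ψ
FreeIn x (φ ∨ᶠ ψ)   = FreeIn x φ ⊎ FreeIn x ψ
FreeIn x (φ →ᶠ ψ)   = FreeIn x φ ⊎ FreeIn x ψ
FreeIn x (¬ᶠ φ)     = FreeIn x φ
FreeIn x (∘ᶠ φ)     = FreeIn x φ
FreeIn x (∀ᶠ y φ)   = x ≢ y × FreeIn x φ
FreeIn x (∃ᶠ y φ)   = x ≢ y × FreeIn x φ

Sentence : For Ω → Set
Sentence φ = ∀ x → ¬ FreeIn x φ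

substTerm : Var → Term Ω → Term Ω → Term Ω
substVec  : ∀ {n} → Var → Term Ω → Vec (Term Ω) n → Vec (Term Ω) n

substTerm x t (var y) with y ≟ x
... | yes _ = t
... | no  _ = var y
substTerm x t (con c)    = con c
substTerm x t (fun f ts) = fun f (substVec x t ts)

substVec x t []       = []
substVec x t (s ∷ ss) = substTerm x t s ∷ substVec x t ss

-- Replaces the free occurrences literally, without renaming bound variables;
-- it is only used under the proviso FreeFor.
_[_/_] : For Ω → Var → Term Ω → For Ω
pre P ts [ x / t ] = pre P (substVec x t ts)
(φ ∧ᶠ ψ) [ x / t ] = (φ [ x / t ]) ∧ᶠ (ψ [ x / t ])
(φ ∨ᶠ ψ) [ x / t ] = (φ [ x / t ]) ∨ᶠ (ψ [ x / t ])
(φ →ᶠ ψ) [ x / t ] = (φ [ x / t ]) →ᶠ (ψ [ x / t ])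
(¬ᶠ φ)   [ x / t ] = ¬ᶠ (φ [ x / t ])
(∘ᶠ φ)   [ x / t ] = ∘ᶠ (φ [ x / t ])
∀ᶠ y φ   [ x / t ] with y ≟ x
... | yes _ = ∀ᶠ y φ
... | no  _ = ∀ᶠ y (φ [ x / t ])
∃ᶠ y φ   [ x / t ] with y ≟ x
... | yes _ = ∃ᶠ y φ
... | no  _ = ∃ᶠ y (φ [ x / t ])

-- t is free for x in φ: no free occurrence of x in φ lies in the scope of a
-- quantifier binding a variable of t.
FreeFor : Term Ω → Var → For Ω → Set
FreeFor t x (pre P ts) = ⊤
FreeFor t x (φ ∧ᶠ ψ)   = FreeFor t x φ × FreeFor t x ψ
FreeFor t x (φ ∨ᶠ ψ)   = FreeFor t x φ × FreeFor t x ψ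
FreeFor t x (φ →ᶠ ψ)   = FreeFor t x φ × FreeFor t x ψ
FreeFor t x (¬ᶠ φ)     = FreeFor t x φ
FreeFor t x (∘ᶠ φ)     = FreeFor t x φ
FreeFor t x (∀ᶠ y φ)   = ¬ FreeIn x (∀ᶠ y φ) ⊎ (¬ OccursIn y t × FreeFor t x φ)
FreeFor t x (∃ᶠ y φ)   = ¬ FreeIn x (∃ᶠ y φ) ⊎ (¬ OccursIn y t × FreeFor t x φ)

------------------------------------------------------------------------
-- The Hilbert calculus RQmbC

data Axiom {Ω : Signature} : For Ω → Set where
  ax1  : ∀ α β → Axiom (α →ᶠ (β →ᶠ α))
  ax2  : ∀ α β γ → Axiom ((α →ᶠ (β →ᶠ γ)) →ᶠ ((α →ᶠ β) →ᶠ (α →ᶠ γ)))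
  ax3  : ∀ α β → Axiom (α →ᶠ (β →ᶠ (α ∧ᶠ β)))
  ax4  : ∀ α β → Axiom ((α ∧ᶠ β) →ᶠ α)
  ax5  : ∀ α β → Axiom ((α ∧ᶠ β) →ᶠ β)
  ax6  : ∀ α β → Axiom (α →ᶠ (α ∨ᶠ β))
  ax7  : ∀ α β → Axiom (β →ᶠ (α ∨ᶠ β))
  ax8  : ∀ α β γ → Axiom ((α →ᶠ γ) →ᶠ ((β →ᶠ γ) →ᶠ ((α ∨ᶠ β) →ᶠ γ)))
  ax9  : ∀ α β → Axiom ((α →ᶠ β) ∨ᶠ α)
  ax10 : ∀ α → Axiom (α ∨ᶠ ¬ᶠ α)
  bc1  : ∀ α β → Axiom (∘ᶠ α →ᶠ (α →ᶠ (¬ᶠ α →ᶠ β)))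
  ax∃  : ∀ φ x t → FreeFor t x φ → Axiom ((φ [ x / t ]) →ᶠ ∃ᶠ x φ)
  ax∀  : ∀ φ x t → FreeFor t x φ → Axiom (∀ᶠ x φ →ᶠ (φ [ x / t ]))

data Rule {Ω : Signature} : List (For Ω) → For Ω → Set where
  mp   : ∀ α β → Rule (α ∷ (α →ᶠ β) ∷ []) β
  r¬   : ∀ α β → Rule ((α ↔ᶠ β) ∷ []) (¬ᶠ α ↔ᶠ ¬ᶠ β)
  r∘   : ∀ α β → Rule ((α ↔ᶠ β) ∷ []) (∘ᶠ α ↔ᶠ ∘ᶠ β)
  ∃-in : ∀ φ ψ x → ¬ FreeIn x ψ → Rule ((φ →ᶠ ψ) ∷ []) (∃ᶠ x φ →ᶠ ψ)
  ∀-in : ∀ φ ψ x → ¬ FreeIn x φ → Rule ((φ →ᶠ ψ) ∷ []) (φ →ᶠ ∀ᶠ x ψ)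

Justified : List (For Ω) → For Ω → Set
Justified Δ φ = Axiom φ ⊎ (∃[ ps ] (Rule ps φ × All (_∈ˡ Δ) ps))

-- Derivations as finite sequences, listed with the last formula first.
data Derivation {Ω : Signature} : List (For Ω) → Set where
  []  : Derivation []
  _∷_ : ∀ {φ Δ} → Justified Δ φ → Derivation Δ → Derivation (φ ∷ Δ)

infix 3 ⊢_ _⊢_

⊢_ : For Ω → Set
⊢ φ = ∃[ Δ ] Derivation (φ ∷ Δ)

⋀ᶠ : List⁺ (For Ω) → For Ω
⋀ᶠ = foldr₁ _∧ᶠ_

_⊢_ : ∀ {g} → Pred (For Ω) g → For Ω → Set g
Γ ⊢ φ = (⊢ φ) ⊎ (∃[ γs ] (All (_∈ Γ) (toList γs) × (⊢ (⋀ᶠ γs →ᶠ φ))))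

------------------------------------------------------------------------
-- BALFIs

record BALFI c e : Set (lsuc (c ⊔ e)) where
  field
    booleanAlgebra : BooleanAlgebra c e

  open BooleanAlgebra booleanAlgebra public
    using (Carrier; _≈_; _∧_; _∨_)
    renaming (¬_ to ∁_; ⊤ to 𝟏; ⊥ to 𝟎)

  infix 8 ¬ᴮ_ ∘ᴮ_

  field
    ¬ᴮ_ ∘ᴮ_ : Op₁ Carrier
    ¬ᴮ-cong : ∀ {a b} → a ≈ b → (¬ᴮ a) ≈ (¬ᴮ b)
    ∘ᴮ-cong : ∀ {a b} → a ≈ b → (∘ᴮ a) ≈ (∘ᴮ b)
    ¬ᴮ-law  : ∀ a → (a ∨ ¬ᴮ a) ≈ 𝟏
    ∘ᴮ-law  : ∀ a → (a ∧ (¬ᴮ a ∧ ∘ᴮ a)) ≈ 𝟎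

  _⇒_ : Op₂ Carrier
  a ⇒ b = (∁ a) ∨ b

  open Poset (LatticeProperties.poset (BooleanAlgebra.lattice booleanAlgebra)) public
    using (_≤_)

  IsSupremum : ∀ {i} {I : Set i} → (I → Carrier) → Carrier → Set (i ⊔ c ⊔ e)
  IsSupremum f s = (∀ i → f i ≤ s) × (∀ b → (∀ i → f i ≤ b) → s ≤ b)

  IsInfimum : ∀ {i} {I : Set i} → (I → Carrier) → Carrier → Set (i ⊔ c ⊔ e)
  IsInfimum f s = (∀ i → s ≤ f i) × (∀ b → (∀ i → b ≤ f i) → b ≤ s)

-- "Set" is read as "type in Set ℓ", and completeness asks for suprema and
-- infima of all families indexed by such types.  Since the regular subsets of
-- a type in Set ℓ only form a type in Set (suc ℓ), the carrier is allowed to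
-- live there, but it must still be of the size of a set: elements are compared
-- in Set ℓ, and each is the supremum of the members below it of a family
-- indexed by a type in Set ℓ.  If the carrier itself is (a lifting of) a type
-- in Set ℓ, it serves as that family; and with excluded middle every subset
-- of the carrier then has a supremum and an infimum, since its supremum is
-- that of the basic elements lying below some member.
record CompleteBALFI ℓ : Set (lsuc (lsuc ℓ)) where
  field
    balfi : BALFI (lsuc ℓ) ℓ

  open BALFI balfi public

  field
    sup : ∀ {I : Set ℓ} (f : I → Carrier) → ∃ (IsSupremum f)
    inf : ∀ {I : Set ℓ} (f : I → Carrier) → ∃ (IsInfimum f)

    Basis     : Set ℓ
    basis     : Basis → Carrier
    basis-sup : ∀ a → IsSupremum {I = Σ Basis (λ b → basis b ≤ a)} (basis ∘ proj₁) a

  ⋁ ⋀ : ∀ {I : Set ℓ} → (I → Carrier) → Carrier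
  ⋁ f = proj₁ (sup f)
  ⋀ f = proj₁ (inf f)

------------------------------------------------------------------------
-- Structures and semantic consequence

record Structure (Ω : Signature) ℓ : Set (lsuc (lsuc ℓ)) where
  field
    U     : Set ℓ
    point : U
    alg   : CompleteBALFI ℓ

  open CompleteBALFI alg public

  field
    conᴵ : Con Ω → U
    funᴵ : ∀ {n} → Fun Ω n → Vec U (suc n) → U
    preᴵ : ∀ {n} → Pre Ω n → Vec U (suc n) → Carrier

  Assignment : Set ℓ
  Assignment = Var → U

  _[_≔_] : Assignment → Var → U → Assignment
  (μ [ x ≔ a ]) y with y ≟ x
  ... | yes _ = a
  ... | no  _ = μ y

  ⟦_⟧ᵗ : Term Ω → Assignment → U
  ⟦_⟧ᵛ : ∀ {n} → Vec (Term Ω) n → Assignment → Vec U n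

  ⟦ var x ⟧ᵗ μ    = μ x
  ⟦ con c ⟧ᵗ μ    = conᴵ c
  ⟦ fun f ts ⟧ᵗ μ = funᴵ f (⟦ ts ⟧ᵛ μ)

  ⟦ [] ⟧ᵛ μ     = []
  ⟦ t ∷ ts ⟧ᵛ μ = ⟦ t ⟧ᵗ μ ∷ ⟦ ts ⟧ᵛ μ

  ⟦_⟧ : For Ω → Assignment → Carrier
  ⟦ pre P ts ⟧ μ = preᴵ P (⟦ ts ⟧ᵛ μ)
  ⟦ φ ∧ᶠ ψ ⟧ μ   = ⟦ φ ⟧ μ ∧ ⟦ ψ ⟧ μ
  ⟦ φ ∨ᶠ ψ ⟧ μ   = ⟦ φ ⟧ μ ∨ ⟦ ψ ⟧ μ
  ⟦ φ →ᶠ ψ ⟧ μ   = ⟦ φ ⟧ μ ⇒ ⟦ ψ ⟧ μ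
  ⟦ ¬ᶠ φ ⟧ μ     = ¬ᴮ ⟦ φ ⟧ μ
  ⟦ ∘ᶠ φ ⟧ μ     = ∘ᴮ ⟦ φ ⟧ μ
  ⟦ ∀ᶠ x φ ⟧ μ   = ⋀ (λ a → ⟦ φ ⟧ (μ [ x ≔ a ]))
  ⟦ ∃ᶠ x φ ⟧ μ   = ⋁ (λ a → ⟦ φ ⟧ (μ [ x ≔ a ]))

Valid : ∀ ℓ → For Ω → Set (lsuc (lsuc ℓ))
Valid {Ω} ℓ φ = (𝔄 : Structure Ω ℓ) → let open Structure 𝔄 in ∀ μ → ⟦ φ ⟧ μ ≈ 𝟏

infix 3 _⊨[_]_

_⊨[_]_ : ∀ {g} → Pred (For Ω) g → ∀ ℓ → For Ω → Set (g ⊔ lsuc (lsuc ℓ))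
Γ ⊨[ ℓ ] φ = Valid ℓ φ ⊎ (∃[ γs ] (All (_∈ Γ) (toList γs) × Valid ℓ (⋀ᶠ γs →ᶠ φ)))

{-# OPTIONS --safe #-}

-- The formulas modulo provable equivalence form a BALFI, since (R¬) and (R∘)
-- make it a congruence for ¬ and ∘.  The MacNeille completion preserves the meets
-- and joins that interpret ∀ and ∃, and ¬ and ∘ extend to it: on the new elements
-- the complement and the constant 1 satisfy the BALFI laws.  In the structure of
-- terms over this completion a formula denotes the class of one of its own
-- substitution instances, hence a valid formula is a theorem.  No ultrafilter or
-- Henkin witness is needed, so the argument is constructive.
module Submission where

open import Defs
open import Algebra.Lattice.Bundles using (BooleanAlgebra)
import Algebra.Lattice.Properties.BooleanAlgebra as BooleanAlgebraProperties
import Algebra.Lattice.Properties.Lattice as LatticeProperties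
open import Algebra.Lattice.Structures.Biased using (isBooleanAlgebraʳ)
open import Data.List.Base using (List; []; _∷_; _++_)
open import Data.List.Membership.Propositional using () renaming (_∈_ to _∈ˡ_)
open import Data.List.Membership.Propositional.Properties using (∈-++⁺ˡ; ∈-++⁺ʳ)
open import Data.List.Relation.Unary.All as All using (All; []; _∷_)
open import Data.List.Relation.Unary.Any using (here; there)
open import Data.Nat.Base using (ℕ; suc; s≤s; _<_)
  renaming (_≤_ to _≤ⁿ_; _⊔_ to _⊔ⁿ_; _⊓_ to _⊓ⁿ_)
import Data.Nat.Properties as ℕ
open import Data.Nat.Properties using (_≟_)
open import Data.Product.Base using (Σ; ∃; _×_; _,_; proj₁; proj₂)
open import Data.Sum.Base using (inj₁; inj₂; [_,_])
open import Data.Unit.Base using (⊤)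
open import Data.Vec.Base using (Vec; []; _∷_; map; replicate)
open import Function.Base using (_∘_; id)
open import Level using (Level; 0ℓ; Lift; lift; lower; _⊔_) renaming (suc to lsuc)
open import Relation.Binary.Bundles using (Poset)
import Relation.Binary.Lattice as Order
import Relation.Binary.Lattice.Properties.DistributiveLattice as OrderDistributive
import Relation.Binary.Lattice.Properties.HeytingAlgebra as OrderHeyting
import Relation.Binary.Lattice.Properties.Lattice as OrderLattice
open import Relation.Binary.PropositionalEquality as ≡
  using (_≡_; _≢_; _≗_; refl; cong; cong₂; subst)
import Relation.Binary.Reasoning.Setoid as SetoidReasoning
open import Relation.Nullary.Decidable.Core using (yes; no)
open import Relation.Nullary.Negation.Core using (¬_; contradiction)
open import Relation.Unary using (Pred; _∈_; _⊆_; _∩_; _∪_)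

-- Boolean algebras and their completions

-- Binders are named and substitution is literal, so an arbitrary assignment of terms has no
-- ready-made instance of a formula: its terms may be captured, and together they may use up every
-- variable. Instances therefore renumber their binders from a counter, and values are computed only
-- at assignments whose terms keep all variables below one bound. Changing an assignment at one
-- variable preserves the existence of a bound, so the recursion through quantifiers stays within
-- this class. The counter is immaterial up to provable equivalence, which allows terms with
-- different bounds to be compared in a single infimum or supremum. The identity assignment is
-- unbounded; cut off above the variables of the given formula, it still returns that formula up to
-- equivalence. Henkin witnesses are avoided because a proposed lower bound of the instances is a
-- finite formula: some variable is fresh for it, and the instance at that variable already yields
-- the quantified formula by the introduction rule.

module AlgebraicBoolean {c ℓ₁ ℓ₂} (B : Order.BooleanAlgebra c ℓ₁ ℓ₂) where
  open Order.BooleanAlgebra B renaming (refl to ≤-refl; trans to ≤-trans; ¬_ to ∁_)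
  open OrderHeyting heytingAlgebra using (⇨-unit; distributiveLattice)
  open OrderDistributive distributiveLattice using (∨-distrib-∧; ∧-distrib-∨)
  open OrderLattice (Order.HeytingAlgebra.lattice heytingAlgebra) using (isAlgLattice)

  private
    ∁x∧x≤⊥ : ∀ x → ∁ x ∧ x ≤ ⊥
    ∁x∧x≤⊥ x = transpose-∧ (x≤x∨y _ _)

    ∁-antitone : ∀ {x y} → y ≤ x → ∁ x ≤ ∁ y
    ∁-antitone y≤x = ≤-trans
      (transpose-⇨ (≤-trans (∧-greatest (x∧y≤x _ _) (≤-trans (x∧y≤y _ _) y≤x)) (∁x∧x≤⊥ _)))
      (∨-least ≤-refl (minimum _))

  -- Residuation does the work: once `∁ x ∨ y` is known to be the exponential, distributivity
  -- follows from the Heyting structure. Both the regular sets and the formulas become Boolean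
  -- algebras this way.
  algBooleanAlgebra : BooleanAlgebra c ℓ₁
  algBooleanAlgebra = record
    { isBooleanAlgebra = isBooleanAlgebraʳ record
      { isDistributiveLattice = record
        { isLattice = isAlgLattice
        ; ∨-distrib-∧ = ∨-distrib-∧
        ; ∧-distrib-∨ = ∧-distrib-∨
        }
      -- `x ⇨ x` is by definition `∁ x ∨ x`, so `⇨-unit` is excluded middle.
      ; ∨-complementʳ = λ x → antisym (maximum _)
          (≤-trans (reflexive (Eq.sym ⇨-unit)) (∨-least (y≤x∨y _ _) (x≤x∨y _ _)))
      ; ∧-complementʳ = λ x → antisym
          (≤-trans (∧-greatest (x∧y≤y _ _) (x∧y≤x _ _)) (∁x∧x≤⊥ x)) (minimum _)
      ; ¬-cong = λ x≈y → antisym (∁-antitone (reflexive (Eq.sym x≈y)))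
                                 (∁-antitone (reflexive x≈y))
      }
    }

  open Poset (LatticeProperties.poset (BooleanAlgebra.lattice algBooleanAlgebra))
    using () renaming (_≤_ to _≤ᵃ_)

  ≤⇒≤ᵃ : ∀ {x y} → x ≤ y → x ≤ᵃ y
  ≤⇒≤ᵃ x≤y = antisym (∧-greatest ≤-refl x≤y) (x∧y≤x _ _)

  ≤ᵃ⇒≤ : ∀ {x y} → x ≤ᵃ y → x ≤ y
  ≤ᵃ⇒≤ x≤y = ≤-trans (reflexive x≤y) (x∧y≤y _ _)

-- The MacNeille completion, built from the sets closed under the polarity of ⊥
-- (a Boolean algebra even without excluded middle).
module Completion {c e} (B : BALFI c e) (ℓ : Level) where
  open BALFI B
  open BooleanAlgebra booleanAlgebra
    using (setoid; sym; trans; ∧-congˡ; ∧-congʳ; ∧-assoc; ∧-comm;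
           ∧-complementʳ; ∧-complementˡ; ∨-complementʳ; ∨-complementˡ; ∧-distribˡ-∨; ∨-congʳ)
  open BooleanAlgebraProperties booleanAlgebra
    using (∧-zeroʳ; ∧-identityʳ; ∧-idem; ∨-identityˡ; ¬-involutive)
  open Order.Lattice (LatticeProperties.∨-∧-orderTheoreticLattice (BooleanAlgebra.lattice booleanAlgebra))
    using (x∧y≤x; x∧y≤y; ∧-greatest; x≤x∨y; y≤x∨y; ∨-least; antisym)
    renaming (refl to ≤-refl; trans to ≤-trans; reflexive to ≤-reflexive)

  private
    L : Level
    L = c ⊔ e ⊔ ℓ

  infix 4 _⊥_
  _⊥_ : Carrier → Carrier → Set e
  a ⊥ b = (a ∧ b) ≈ 𝟎

  ⊥-sym : ∀ {a b} → a ⊥ b → b ⊥ a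
  ⊥-sym = trans (∧-comm _ _)

  ⊥-shiftˡ : ∀ {a b c} → a ⊥ (b ∧ c) → (a ∧ b) ⊥ c
  ⊥-shiftˡ = trans (∧-assoc _ _ _)

  ⊥-downˡ : ∀ {a b c} → a ≤ b → b ⊥ c → a ⊥ c
  ⊥-downˡ {a} {b} {c} a≤b b⊥c = begin
    a ∧ c        ≈⟨ ∧-congʳ a≤b ⟩
    (a ∧ b) ∧ c  ≈⟨ ∧-assoc a b c ⟩
    a ∧ (b ∧ c)  ≈⟨ ∧-congˡ b⊥c ⟩
    a ∧ 𝟎        ≈⟨ ∧-zeroʳ a ⟩
    𝟎            ∎
    where open SetoidReasoning setoid

  ⊥-diagonal : ∀ {a b} → a ⊥ (a ∧ b) → a ⊥ b
  ⊥-diagonal a⊥ = trans (sym (∧-congʳ (∧-idem _))) (⊥-shiftˡ a⊥)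

  -- Stated for any `b` covering `𝟏` together with `a`, because it serves both the Boolean
  -- complement and the paraconsistent `¬ᴮ`.
  ⊥∧cover⇒≤ : ∀ {a b x} → (a ∨ b) ≈ 𝟏 → x ⊥ a → x ≤ b
  ⊥∧cover⇒≤ {a} {b} {x} a∨b≈𝟏 x⊥a = begin
    x                  ≈⟨ ∧-identityʳ x ⟨
    x ∧ 𝟏              ≈⟨ ∧-congˡ a∨b≈𝟏 ⟨
    x ∧ (a ∨ b)        ≈⟨ ∧-distribˡ-∨ x a b ⟩
    (x ∧ a) ∨ (x ∧ b)  ≈⟨ ∨-congʳ x⊥a ⟩
    𝟎 ∨ (x ∧ b)        ≈⟨ ∨-identityˡ _ ⟩
    x ∧ b              ∎
    where open SetoidReasoning setoid

  ⊥⇒≤∁ : ∀ {a b} → a ⊥ b → a ≤ ∁ b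
  ⊥⇒≤∁ = ⊥∧cover⇒≤ (∨-complementʳ _)

  ≤∁⇒⊥ : ∀ {a b} → a ≤ ∁ b → a ⊥ b
  ≤∁⇒⊥ a≤∁b = ⊥-downˡ a≤∁b (∧-complementˡ _)

  ⊥∁⇒≤ : ∀ {a b} → a ⊥ ∁ b → a ≤ b
  ⊥∁⇒≤ a⊥∁b = ⊥∧cover⇒≤ (∨-complementˡ _) a⊥∁b

  infix 9 _^⊥
  -- `b` is in `P ^⊥` exactly when `∁ b` is an upper bound of `P`. The double polar thus consists of
  -- the lower bounds of all upper bounds: it is the MacNeille cut generated by `P`.
  _^⊥ : Pred Carrier L → Pred Carrier L
  (P ^⊥) b = ∀ {a} → a ∈ P → b ⊥ a

  ^⊥-antitone : ∀ {P Q} → P ⊆ Q → Q ^⊥ ⊆ P ^⊥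
  ^⊥-antitone P⊆Q b⊥Q a∈P = b⊥Q (P⊆Q a∈P)

  ⊆^⊥⊥ : ∀ P → P ⊆ P ^⊥ ^⊥
  ⊆^⊥⊥ P a∈P b∈P⊥ = ⊥-sym (b∈P⊥ a∈P)

  record Regular : Set (lsuc L) where
    no-eta-equality
    field
      member : Pred Carrier L
      closed : member ^⊥ ^⊥ ⊆ member

  open Regular

  infix 4 _⊑_
  record _⊑_ (X Y : Regular) : Set L where
    constructor mk⊑
    field incl : member X ⊆ member Y

  open _⊑_

  down : ∀ (X : Regular) {a b} → a ≤ b → b ∈ member X → a ∈ member X
  down X a≤b b∈X = closed X (λ c∈X⊥ → ⊥-downˡ a≤b (⊥-sym (c∈X⊥ b∈X)))

  ^⊥-closed : ∀ P → P ^⊥ ^⊥ ^⊥ ⊆ P ^⊥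
  ^⊥-closed P = ^⊥-antitone {P} (⊆^⊥⊥ P)

  ^⊥⊥-least : ∀ {P} X → P ⊆ member X → P ^⊥ ^⊥ ⊆ member X
  ^⊥⊥-least {P} X P⊆X =
    closed X ∘ ^⊥-antitone {member X ^⊥} (^⊥-antitone {P} P⊆X)

  principal : Carrier → Regular
  member (principal a) b = Lift L (b ≤ a)
  -- `∁ a` is disjoint from everything below `a`, so an element of the double polar is disjoint from
  -- `∁ a`.
  closed (principal a) b∈ = lift (⊥∁⇒≤ (b∈ λ { (lift d≤a) →
    ⊥-sym (⊥-downˡ d≤a (∧-complementʳ a)) }))

  infixr 7 _⊓_
  infixr 6 _⊔ᴿ_
  infix 8 ∁ᴿ_

  _⊓_ _⊔ᴿ_ : Regular → Regular → Regular
  member (X ⊓ Y) = member X ∩ member Y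
  closed (X ⊓ Y) a∈ =
    ^⊥⊥-least {member X ∩ member Y} X proj₁ a∈ , ^⊥⊥-least {member X ∩ member Y} Y proj₂ a∈
  member (X ⊔ᴿ Y) = (member X ∪ member Y) ^⊥ ^⊥
  closed (X ⊔ᴿ Y) = ^⊥-closed ((member X ∪ member Y) ^⊥)

  ∁ᴿ_ : Regular → Regular
  member (∁ᴿ X) = member X ^⊥
  closed (∁ᴿ X) = ^⊥-closed (member X)

  𝟏ᴿ 𝟎ᴿ : Regular
  member 𝟏ᴿ _ = Lift L ⊤
  closed 𝟏ᴿ = _
  member 𝟎ᴿ = member 𝟏ᴿ ^⊥
  closed 𝟎ᴿ = ^⊥-closed (member 𝟏ᴿ)

  ⋁ᴿ ⋀ᴿ : ∀ {I : Set L} → (I → Regular) → Regular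
  member (⋁ᴿ f) = (λ a → ∃ λ i → a ∈ member (f i)) ^⊥ ^⊥
  closed (⋁ᴿ f) = ^⊥-closed ((λ a → ∃ λ i → a ∈ member (f i)) ^⊥)
  member (⋀ᴿ f) a = ∀ i → a ∈ member (f i)
  closed (⋀ᴿ f) a∈ i = ^⊥⊥-least {λ a → ∀ i → a ∈ member (f i)} (f i) (λ a∈⋀ → a∈⋀ i) a∈

  regularBooleanAlgebra : Order.BooleanAlgebra (lsuc L) L L
  regularBooleanAlgebra = record
    { Carrier = Regular
    ; _≈_ = λ X Y → X ⊑ Y × Y ⊑ X
    ; _≤_ = _⊑_
    ; _∨_ = _⊔ᴿ_
    ; _∧_ = _⊓_
    ; ¬_ = ∁ᴿ_
    ; ⊤ = 𝟏ᴿ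
    ; ⊥ = 𝟎ᴿ
    ; isBooleanAlgebra = record
      { isHeytingAlgebra = record
        { isBoundedLattice = record
          { isLattice = record
            { isPartialOrder = record
              { isPreorder = record
                { isEquivalence = record
                  { refl = mk⊑ id , mk⊑ id
                  ; sym = λ (p , q) → q , p
                  ; trans = λ (p , q) (p′ , q′) → mk⊑ (incl p′ ∘ incl p) , mk⊑ (incl q ∘ incl q′)
                  }
                ; reflexive = proj₁
                ; trans = λ p q → mk⊑ (incl q ∘ incl p)
                }
              ; antisym = _,_
              }
            ; supremum = λ X Y →
                  mk⊑ (⊆^⊥⊥ (member X ∪ member Y) ∘ inj₁)
                , mk⊑ (⊆^⊥⊥ (member X ∪ member Y) ∘ inj₂)
                , λ Z X⊑Z Y⊑Z → mk⊑ (^⊥⊥-least {member X ∪ member Y} Z [ incl X⊑Z , incl Y⊑Z ])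
            ; infimum = λ X Y →
                mk⊑ proj₁ , mk⊑ proj₂ , λ Z Z⊑X Z⊑Y → mk⊑ λ a∈ → incl Z⊑X a∈ , incl Z⊑Y a∈
            }
          ; maximum = λ _ → mk⊑ _
          ; minimum = λ X → mk⊑ λ a⊥𝟏 → closed X (λ _ → a⊥𝟏 _)
          }
        ; exponential = λ X Y Z →
              -- `c` is disjoint from `Z`, hence from every `b ∧ y` with `y` in `Y`. So `c ∧ b` lies
              -- in the polar of `Y`, from which `c` is disjoint too; `c ⊥ (c ∧ b)` gives `c ⊥ b`.
              (λ X⊓Y⊑Z → mk⊑ λ {b} b∈X {c} c⊥ → ⊥-sym (⊥-diagonal (c⊥ (inj₁ λ {y} y∈Y →
                ⊥-shiftˡ (c⊥ (inj₂ (incl X⊓Y⊑Z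
                  (down X (x∧y≤x b y) b∈X , down Y (x∧y≤y b y) y∈Y))))))))
            -- For `c` disjoint from `Z`, the meet `b ∧ c` is disjoint from the polar of `Y` through
            -- `b` and from `Z` through `c`.
            , λ X⊑ → mk⊑ λ {b} (b∈X , b∈Y) → closed Z (λ {c} c⊥Z → ⊥-diagonal
                (incl X⊑ b∈X λ
                  { (inj₁ d∈Y⊥) → ⊥-downˡ (x∧y≤x b c) (⊥-sym (d∈Y⊥ b∈Y))
                  ; (inj₂ d∈Z) → ⊥-downˡ (x∧y≤y b c) (c⊥Z d∈Z) }))
        }
      }
    }

  open AlgebraicBoolean regularBooleanAlgebra
  open Order.BooleanAlgebra regularBooleanAlgebra using () renaming (_≈_ to _≈ᴿ_)
  private
    module R = Order.BooleanAlgebra regularBooleanAlgebra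
    module Rᵃ = BooleanAlgebra algBooleanAlgebra

  ⋁ᴿ-upper : ∀ {I : Set L} (f : I → Regular) i → f i ⊑ ⋁ᴿ f
  ⋁ᴿ-upper f i = mk⊑ λ a∈ → ⊆^⊥⊥ _ (i , a∈)

  ⋁ᴿ-least : ∀ {I : Set L} (f : I → Regular) X → (∀ i → f i ⊑ X) → ⋁ᴿ f ⊑ X
  ⋁ᴿ-least f X f⊑X = mk⊑ (^⊥⊥-least {λ a → ∃ λ i → a ∈ member (f i)} X λ (i , a∈) → incl (f⊑X i) a∈)

  ⋀ᴿ-lower : ∀ {I : Set L} (f : I → Regular) i → ⋀ᴿ f ⊑ f i
  ⋀ᴿ-lower f i = mk⊑ λ a∈ → a∈ i

  ⋀ᴿ-greatest : ∀ {I : Set L} (f : I → Regular) X → (∀ i → X ⊑ f i) → X ⊑ ⋀ᴿ f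
  ⋀ᴿ-greatest f X X⊑f = mk⊑ λ a∈ i → incl (X⊑f i) a∈

  Generator : Regular → Set L
  Generator X = Σ Carrier λ a → X ≈ᴿ principal a

  -- On principal elements these agree with ¬ᴮ and ∘ᴮ; without deciding
  -- principality, the joins and meets over all generators extend them to the
  -- other elements, where ¬ᴿ is the complement and ∘ᴿ is 𝟏.
  ¬ᴿ_ ∘ᴿ_ : Regular → Regular
  ¬ᴿ X = ∁ᴿ X ⊔ᴿ ⋁ᴿ {Generator X} (λ (a , _) → principal (¬ᴮ a))
  ∘ᴿ X = ∁ᴿ (X ⊓ ¬ᴿ X) ⊓ ⋀ᴿ {Generator X} (λ (a , _) → principal (∘ᴮ a))

  ¬ᴿ-monotone : ∀ {X Y} → X ≈ᴿ Y → ¬ᴿ X ⊑ ¬ᴿ Y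
  ¬ᴿ-monotone {X} {Y} X≈Y = R.∨-least
    (R.trans (R.reflexive (Rᵃ.¬-cong X≈Y)) (R.x≤x∨y _ _))
    (R.trans (⋁ᴿ-least _ _ λ (a , X≈) → ⋁ᴿ-upper _ (a , R.Eq.trans (R.Eq.sym X≈Y) X≈))
             (R.y≤x∨y _ _))

  ¬ᴿ-cong : ∀ {X Y} → X ≈ᴿ Y → ¬ᴿ X ≈ᴿ ¬ᴿ Y
  ¬ᴿ-cong X≈Y = ¬ᴿ-monotone X≈Y , ¬ᴿ-monotone (R.Eq.sym X≈Y)

  ∘ᴿ-monotone : ∀ {X Y} → X ≈ᴿ Y → ∘ᴿ X ⊑ ∘ᴿ Y
  ∘ᴿ-monotone {X} {Y} X≈Y = R.∧-greatest
    (R.trans (R.x∧y≤x _ _) (R.reflexive (Rᵃ.¬-cong (Rᵃ.∧-cong X≈Y (¬ᴿ-cong X≈Y)))))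
    (R.trans (R.x∧y≤y _ _)
             (⋀ᴿ-greatest _ _ λ (a , Y≈) → ⋀ᴿ-lower _ (a , R.Eq.trans X≈Y Y≈)))

  ∘ᴿ-cong : ∀ {X Y} → X ≈ᴿ Y → ∘ᴿ X ≈ᴿ ∘ᴿ Y
  ∘ᴿ-cong X≈Y = ∘ᴿ-monotone X≈Y , ∘ᴿ-monotone (R.Eq.sym X≈Y)

  completion : CompleteBALFI L
  completion = record
    { balfi = record
      { booleanAlgebra = algBooleanAlgebra
      ; ¬ᴮ_ = ¬ᴿ_
      ; ∘ᴮ_ = ∘ᴿ_
      ; ¬ᴮ-cong = ¬ᴿ-cong
      ; ∘ᴮ-cong = ∘ᴿ-cong
      ; ¬ᴮ-law = λ X → R.antisym (R.maximum _) (R.trans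
          (R.reflexive (R.Eq.sym (Rᵃ.∨-complementʳ X)))
          (R.∨-least (R.x≤x∨y _ _) (R.trans (R.x≤x∨y _ _) (R.y≤x∨y _ _))))
      ; ∘ᴮ-law = λ X → R.antisym
          (R.trans
            (R.∧-greatest
              (R.∧-greatest (R.x∧y≤x _ _) (R.trans (R.x∧y≤y _ _) (R.x∧y≤x _ _)))
              (R.trans (R.x∧y≤y _ _) (R.trans (R.x∧y≤y _ _) (R.x∧y≤x _ _))))
            (R.reflexive (Rᵃ.∧-complementʳ (X ⊓ ¬ᴿ X))))
          (R.minimum _)
      }
    ; sup = λ f → ⋁ᴿ f , (λ i → ≤⇒≤ᵃ (⋁ᴿ-upper f i)) ,
        λ X f≤X → ≤⇒≤ᵃ (⋁ᴿ-least f X (λ i → ≤ᵃ⇒≤ (f≤X i)))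
    ; inf = λ f → ⋀ᴿ f , (λ i → ≤⇒≤ᵃ (⋀ᴿ-lower f i)) ,
        λ X X≤f → ≤⇒≤ᵃ (⋀ᴿ-greatest f X (λ i → ≤ᵃ⇒≤ (X≤f i)))
    ; Basis = Lift L Carrier
    ; basis = principal ∘ lower
    -- For `a` in `X` the principal set of `a` lies within `X`, hence within any upper bound `Y`,
    -- which puts `a` in `Y`.
    ; basis-sup = λ X → proj₂ , λ Y ↓≤Y → ≤⇒≤ᵃ (mk⊑ λ {a} a∈X →
        incl (≤ᵃ⇒≤ (↓≤Y (lift a , ≤⇒≤ᵃ (mk⊑ λ (lift b≤a) → down X b≤a a∈X))))
             (lift ≤-refl))
    }

  principal-monotone : ∀ {a b} → a ≤ b → principal a ⊑ principal b
  principal-monotone a≤b = mk⊑ λ (lift x≤a) → lift (≤-trans x≤a a≤b)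

  principal-reflects : ∀ {a b} → principal a ⊑ principal b → a ≤ b
  principal-reflects ↓a⊑↓b = lower (incl ↓a⊑↓b (lift ≤-refl))

  principal-cong : ∀ {a b} → a ≈ b → principal a ≈ᴿ principal b
  principal-cong a≈b =
    principal-monotone (≤-reflexive a≈b) , principal-monotone (≤-reflexive (sym a≈b))

  principal-injective : ∀ {a b} → principal a ≈ᴿ principal b → a ≈ b
  principal-injective (↓a⊑↓b , ↓b⊑↓a) =
    antisym (principal-reflects ↓a⊑↓b) (principal-reflects ↓b⊑↓a)

  principal-𝟏 : principal 𝟏 ≈ᴿ 𝟏ᴿ
  principal-𝟏 = mk⊑ _ , mk⊑ λ _ → lift (sym (∧-identityʳ _))

  principal-∧ : ∀ a b → (principal a ⊓ principal b) ≈ᴿ principal (a ∧ b)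
  principal-∧ a b =
      mk⊑ (λ (lift x≤a , lift x≤b) → lift (∧-greatest x≤a x≤b))
    , R.∧-greatest (principal-monotone (x∧y≤x a b)) (principal-monotone (x∧y≤y a b))

  principal-∨ : ∀ a b → (principal a ⊔ᴿ principal b) ≈ᴿ principal (a ∨ b)
  principal-∨ a b =
      R.∨-least (principal-monotone (x≤x∨y a b)) (principal-monotone (y≤x∨y a b))
    , mk⊑ λ (lift x≤a∨b) {c} c⊥ → ≤∁⇒⊥ (≤-trans x≤a∨b (∨-least
        (⊥⇒≤∁ (⊥-sym (c⊥ (inj₁ (lift ≤-refl)))))
        (⊥⇒≤∁ (⊥-sym (c⊥ (inj₂ (lift ≤-refl)))))))

  principal-∁ : ∀ a → ∁ᴿ (principal a) ≈ᴿ principal (∁ a)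
  principal-∁ a =
      mk⊑ (λ x⊥ → lift (⊥⇒≤∁ (x⊥ (lift ≤-refl))))
    , mk⊑ λ (lift x≤∁a) (lift y≤a) → ⊥-sym (⊥-downˡ y≤a (⊥-sym (≤∁⇒⊥ x≤∁a)))

  -- `a ∨ ¬ᴮ a ≈ 𝟏` puts the complement of `a` below `¬ᴮ a`, so the summand `∁ᴿ` adds nothing. All
  -- generators of a principal set are equal, so the join has one value.
  principal-¬ : ∀ a → ¬ᴿ (principal a) ≈ᴿ principal (¬ᴮ a)
  principal-¬ a =
      R.∨-least
        (mk⊑ λ x⊥ → lift (⊥∧cover⇒≤ (¬ᴮ-law a) (x⊥ (lift ≤-refl))))
        (⋁ᴿ-least _ _ λ (b , ↓a≈↓b) →
          principal-monotone (≤-reflexive (¬ᴮ-cong (sym (principal-injective ↓a≈↓b)))))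
    , R.trans (⋁ᴿ-upper _ (a , R.Eq.refl)) (R.y≤x∨y _ _)

  -- Dually, `∘ᴮ-law` makes `∘ᴮ a` disjoint from `a ∧ ¬ᴮ a`, hence it lies below the complement that
  -- forms the first factor.
  principal-∘ : ∀ a → ∘ᴿ (principal a) ≈ᴿ principal (∘ᴮ a)
  principal-∘ a =
      R.trans (R.x∧y≤y _ _) (⋀ᴿ-lower _ (a , R.Eq.refl))
    , R.∧-greatest
        (mk⊑ λ (lift x≤∘a) (lift y≤a , y∈¬) →
          ⊥-downˡ x≤∘a (⊥-sym (⊥-downˡ (∧-greatest y≤a (lower (incl (proj₁ (principal-¬ a)) y∈¬)))
            (trans (∧-assoc _ _ _) (∘ᴮ-law a)))))
        (⋀ᴿ-greatest _ _ λ (b , ↓a≈↓b) →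
          principal-monotone (≤-reflexive (∘ᴮ-cong (principal-injective ↓a≈↓b))))

  principal-⋀ : ∀ {I : Set L} {F : I → Regular} {f : I → Carrier} {s} →
    (∀ i → F i ≈ᴿ principal (f i)) → IsInfimum f s → ⋀ᴿ F ≈ᴿ principal s
  principal-⋀ F≈↓f (s≤f , greatest) =
      mk⊑ (λ a∈⋀ → lift (greatest _ λ i → lower (incl (proj₁ (F≈↓f i)) (a∈⋀ i))))
    , ⋀ᴿ-greatest _ _ λ i → R.trans (principal-monotone (s≤f i)) (proj₂ (F≈↓f i))

  -- If `c` is disjoint from every `f i`, then `∁ c` bounds the family, so `s ≤ ∁ c`: the double
  -- polar gains nothing beyond `s`.
  principal-⋁ : ∀ {I : Set L} {F : I → Regular} {f : I → Carrier} {s} →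
    (∀ i → F i ≈ᴿ principal (f i)) → IsSupremum f s → ⋁ᴿ F ≈ᴿ principal s
  principal-⋁ F≈↓f (f≤s , least) =
      ⋁ᴿ-least _ _ (λ i → R.trans (proj₁ (F≈↓f i)) (principal-monotone (f≤s i)))
    , mk⊑ λ (lift x≤s) {c} c⊥ → ≤∁⇒⊥ (≤-trans x≤s (least _ λ i →
        ⊥⇒≤∁ (⊥-sym (c⊥ (i , incl (proj₂ (F≈↓f i)) (lift ≤-refl))))))

-- The Lindenbaum algebra

Justified-mono : ∀ {Δ Δ′ : List (For Ω)} {φ} →
  (∀ {ψ} → ψ ∈ˡ Δ → ψ ∈ˡ Δ′) → Justified Δ φ → Justified Δ′ φ
Justified-mono Δ⊆Δ′ (inj₁ ax)             = inj₁ ax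
Justified-mono Δ⊆Δ′ (inj₂ (ps , r , ps∈)) = inj₂ (ps , r , All.map Δ⊆Δ′ ps∈)

Derivation-++ : ∀ {Δ Δ′ : List (For Ω)} →
  Derivation Δ → Derivation Δ′ → Derivation (Δ ++ Δ′)
Derivation-++ []      d′ = d′
Derivation-++ (j ∷ d) d′ = Justified-mono ∈-++⁺ˡ j ∷ Derivation-++ d d′

⊢-axiom : ∀ {φ : For Ω} → Axiom φ → ⊢ φ
⊢-axiom ax = [] , (inj₁ ax ∷ [])

-- A derivation is one sequence, so those of the premises are concatenated before the rule is
-- applied.
⊢-rule : ∀ {ps} {φ : For Ω} → Rule ps φ → All ⊢_ ps → ⊢ φ
⊢-rule {ps = ps} r ⊢ps = let Δ , d , ps∈ = collect ⊢ps in Δ , (inj₂ (ps , r , ps∈) ∷ d)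
  where
  collect : ∀ {qs} → All ⊢_ qs → ∃ λ Δ → Derivation Δ × All (_∈ˡ Δ) qs
  collect []               = [] , [] , []
  collect ((Δ , d) ∷ ⊢qs) =
    let Δ′ , d′ , qs∈ = collect ⊢qs in
    _ , Derivation-++ d d′ , here refl ∷ All.map (∈-++⁺ʳ (_ ∷ Δ)) qs∈

⊢-mp : ∀ {α β : For Ω} → ⊢ (α →ᶠ β) → ⊢ α → ⊢ β
⊢-mp ⊢α→β ⊢α = ⊢-rule (mp _ _) (⊢α ∷ ⊢α→β ∷ [])

infix 4 _≼_
_≼_ : For Ω → For Ω → Set
α ≼ β = ⊢ (α →ᶠ β)

weaken : ∀ {α β : For Ω} → ⊢ β → α ≼ β
weaken = ⊢-mp (⊢-axiom (ax1 _ _))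

→-distrib : ∀ {α β γ : For Ω} → α ≼ β →ᶠ γ → α ≼ β → α ≼ γ
→-distrib p q = ⊢-mp (⊢-mp (⊢-axiom (ax2 _ _ _)) p) q

≼-trans : ∀ {α β γ : For Ω} → α ≼ β → β ≼ γ → α ≼ γ
≼-trans p q = →-distrib (weaken q) p

≼-refl : ∀ {α : For Ω} → α ≼ α
≼-refl {α = α} = →-distrib {β = α →ᶠ α} (⊢-axiom (ax1 _ _)) (⊢-axiom (ax1 _ _))

∧ᶠ-≼ˡ : ∀ {α β : For Ω} → α ∧ᶠ β ≼ α
∧ᶠ-≼ˡ = ⊢-axiom (ax4 _ _)

∧ᶠ-≼ʳ : ∀ {α β : For Ω} → α ∧ᶠ β ≼ β
∧ᶠ-≼ʳ = ⊢-axiom (ax5 _ _)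

∧ᶠ-greatest : ∀ {α β γ : For Ω} → α ≼ β → α ≼ γ → α ≼ β ∧ᶠ γ
∧ᶠ-greatest p q = →-distrib (≼-trans p (⊢-axiom (ax3 _ _))) q

∨ᶠ-≽ˡ : ∀ {α β : For Ω} → α ≼ α ∨ᶠ β
∨ᶠ-≽ˡ = ⊢-axiom (ax6 _ _)

∨ᶠ-≽ʳ : ∀ {α β : For Ω} → β ≼ α ∨ᶠ β
∨ᶠ-≽ʳ = ⊢-axiom (ax7 _ _)

∨ᶠ-least : ∀ {α β γ : For Ω} → α ≼ γ → β ≼ γ → α ∨ᶠ β ≼ γ
∨ᶠ-least p q = ⊢-mp (⊢-mp (⊢-axiom (ax8 _ _ _)) p) q

curry : ∀ {α β γ : For Ω} → α ∧ᶠ β ≼ γ → α ≼ β →ᶠ γ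
curry p = ≼-trans (⊢-axiom (ax3 _ _)) (⊢-mp (⊢-axiom (ax2 _ _ _)) (weaken p))

uncurry : ∀ {α β γ : For Ω} → α ≼ β →ᶠ γ → α ∧ᶠ β ≼ γ
uncurry p = →-distrib (≼-trans ∧ᶠ-≼ˡ p) ∧ᶠ-≼ʳ

∧ᶠ-swap : ∀ {α β : For Ω} → α ∧ᶠ β ≼ β ∧ᶠ α
∧ᶠ-swap = ∧ᶠ-greatest ∧ᶠ-≼ʳ ∧ᶠ-≼ˡ

∧ᶠ-mono : ∀ {α α′ β β′ : For Ω} → α ≼ α′ → β ≼ β′ → α ∧ᶠ β ≼ α′ ∧ᶠ β′
∧ᶠ-mono p q = ∧ᶠ-greatest (≼-trans ∧ᶠ-≼ˡ p) (≼-trans ∧ᶠ-≼ʳ q)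

∨ᶠ-mono : ∀ {α α′ β β′ : For Ω} → α ≼ α′ → β ≼ β′ → α ∨ᶠ β ≼ α′ ∨ᶠ β′
∨ᶠ-mono p q = ∨ᶠ-least (≼-trans p ∨ᶠ-≽ˡ) (≼-trans q ∨ᶠ-≽ʳ)

→ᶠ-mono : ∀ {α α′ β β′ : For Ω} → α′ ≼ α → β ≼ β′ → α →ᶠ β ≼ α′ →ᶠ β′
→ᶠ-mono p q = curry (≼-trans (∧ᶠ-mono ≼-refl p) (≼-trans (uncurry ≼-refl) q))

↔ᶠ-intro : ∀ {α β : For Ω} → α ≼ β → β ≼ α → ⊢ (α ↔ᶠ β)
↔ᶠ-intro p q = ⊢-mp (⊢-mp (⊢-axiom (ax3 _ _)) p) q

¬ᶠ-mono : ∀ {α β : For Ω} → α ≼ β → β ≼ α → ¬ᶠ α ≼ ¬ᶠ β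
¬ᶠ-mono p q = ⊢-mp ∧ᶠ-≼ˡ (⊢-rule (r¬ _ _) (↔ᶠ-intro p q ∷ []))

∘ᶠ-mono : ∀ {α β : For Ω} → α ≼ β → β ≼ α → ∘ᶠ α ≼ ∘ᶠ β
∘ᶠ-mono p q = ⊢-mp ∧ᶠ-≼ˡ (⊢-rule (r∘ _ _) (↔ᶠ-intro p q ∷ []))

⊢-∀-in : ∀ {φ ψ : For Ω} {x} → ¬ FreeIn x φ → φ ≼ ψ → φ ≼ ∀ᶠ x ψ
⊢-∀-in x∉φ p = ⊢-rule (∀-in _ _ _ x∉φ) (p ∷ [])

⊢-∃-in : ∀ {φ ψ : For Ω} {x} → ¬ FreeIn x ψ → φ ≼ ψ → ∃ᶠ x φ ≼ ψ
⊢-∃-in x∉ψ p = ⊢-rule (∃-in _ _ _ x∉ψ) (p ∷ [])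

module Lindenbaum (Ω : Signature) where

  private
    P₀ : For Ω
    P₀ = let n , P = Pre-nonempty Ω in pre P (replicate _ (var 0))

  -- The language has no falsum; by bc1 a formula together with its negation and its consistency
  -- entails everything. `Pre-nonempty` supplies the atom.
  ⊥ᶠ ⊤ᶠ : For Ω
  ⊥ᶠ = P₀ ∧ᶠ (¬ᶠ P₀ ∧ᶠ ∘ᶠ P₀)
  ⊤ᶠ = ⊥ᶠ →ᶠ ⊥ᶠ

  -- The order-theoretic _⇨_ is ∁ᶠ α ∨ᶠ β, not α →ᶠ β.
  ∁ᶠ_ : For Ω → For Ω
  ∁ᶠ α = α →ᶠ ⊥ᶠ

  -- Holding for every `α`, it gives both the least element, at `P₀`, and the BALFI law for `∘ᶠ`.
  gentle-explosion : ∀ {α β : For Ω} → α ∧ᶠ (¬ᶠ α ∧ᶠ ∘ᶠ α) ≼ β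
  gentle-explosion = →-distrib
    (→-distrib (≼-trans (≼-trans ∧ᶠ-≼ʳ ∧ᶠ-≼ʳ) (⊢-axiom (bc1 _ _))) ∧ᶠ-≼ˡ)
    (≼-trans ∧ᶠ-≼ʳ ∧ᶠ-≼ˡ)

  ∁∨⇒→ : ∀ {α β} → (∁ᶠ α) ∨ᶠ β ≼ α →ᶠ β
  ∁∨⇒→ = ∨ᶠ-least (curry (≼-trans (uncurry ≼-refl) gentle-explosion)) (⊢-axiom (ax1 _ _))

  -- Case split on the instance `∁ᶠ α ∨ᶠ α` of Ax9: in the second case `α` and `α →ᶠ β` give `β`.
  →⇒∁∨ : ∀ {α β} → α →ᶠ β ≼ (∁ᶠ α) ∨ᶠ β
  →⇒∁∨ = ⊢-mp
    (∨ᶠ-least (curry (≼-trans ∧ᶠ-≼ˡ ∨ᶠ-≽ˡ))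
              (curry (≼-trans ∧ᶠ-swap (≼-trans (uncurry ≼-refl) ∨ᶠ-≽ʳ))))
    (⊢-axiom (ax9 _ _))

  orderBooleanAlgebra : Order.BooleanAlgebra 0ℓ 0ℓ 0ℓ
  orderBooleanAlgebra = record
    { Carrier = For Ω
    ; _≈_ = λ α β → α ≼ β × β ≼ α
    ; _≤_ = _≼_
    ; _∨_ = _∨ᶠ_
    ; _∧_ = _∧ᶠ_
    ; ¬_ = ∁ᶠ_
    ; ⊤ = ⊤ᶠ
    ; ⊥ = ⊥ᶠ
    ; isBooleanAlgebra = record
      { isHeytingAlgebra = record
        { isBoundedLattice = record
          { isLattice = record
            { isPartialOrder = record
              { isPreorder = record
                { isEquivalence = record
                  { refl = ≼-refl , ≼-refl
                  ; sym = λ (p , q) → q , p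
                  ; trans = λ (p , q) (p′ , q′) → ≼-trans p p′ , ≼-trans q′ q
                  }
                ; reflexive = proj₁
                ; trans = ≼-trans
                }
              ; antisym = _,_
              }
            ; supremum = λ _ _ → ∨ᶠ-≽ˡ , ∨ᶠ-≽ʳ , λ _ → ∨ᶠ-least
            ; infimum = λ _ _ → ∧ᶠ-≼ˡ , ∧ᶠ-≼ʳ , λ _ → ∧ᶠ-greatest
            }
          ; maximum = λ _ → weaken ≼-refl
          ; minimum = λ _ → gentle-explosion
          }
        ; exponential = λ _ _ _ →
            (λ p → ≼-trans (curry p) →⇒∁∨) , (λ p → uncurry (≼-trans p ∁∨⇒→))
        }
      }
    }

  open AlgebraicBoolean orderBooleanAlgebra public

  lindenbaum : BALFI 0ℓ 0ℓ
  lindenbaum = record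
    { booleanAlgebra = algBooleanAlgebra
    ; ¬ᴮ_ = ¬ᶠ_
    ; ∘ᴮ_ = ∘ᶠ_
    ; ¬ᴮ-cong = λ (p , q) → ¬ᶠ-mono p q , ¬ᶠ-mono q p
    ; ∘ᴮ-cong = λ (p , q) → ∘ᶠ-mono p q , ∘ᶠ-mono q p
    ; ¬ᴮ-law = λ _ → weaken ≼-refl , weaken (⊢-axiom (ax10 _))
    ; ∘ᴮ-law = λ _ → gentle-explosion , gentle-explosion
    }

-- Substitution with renaming of bound variables

Subst : Signature → Set
Subst Ω = Var → Term Ω

_[_↦_] : Subst Ω → Var → Term Ω → Subst Ω
(μ [ x ↦ t ]) y with y ≟ x
... | yes _ = t
... | no  _ = μ y

↦-cong : ∀ {μ ν : Subst Ω} {x t} → μ ≗ ν → μ [ x ↦ t ] ≗ ν [ x ↦ t ]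
↦-cong {x = x} μ≗ν y with y ≟ x
... | yes _ = refl
... | no  _ = μ≗ν y

infix 9 _⟨_⟩ _⟨_⟩ᵛ
_⟨_⟩  : Term Ω → Subst Ω → Term Ω
_⟨_⟩ᵛ : ∀ {n} → Vec (Term Ω) n → Subst Ω → Vec (Term Ω) n

var x ⟨ μ ⟩    = μ x
con c ⟨ μ ⟩    = con c
fun f ts ⟨ μ ⟩ = fun f (ts ⟨ μ ⟩ᵛ)

[] ⟨ μ ⟩ᵛ       = []
(t ∷ ts) ⟨ μ ⟩ᵛ = t ⟨ μ ⟩ ∷ ts ⟨ μ ⟩ᵛ

-- Simultaneous substitution that renames the bound variables to n, n + 1, …
-- inwards; it avoids capture as soon as all variables of μ are below n.
inst : ℕ → For Ω → Subst Ω → For Ω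
inst n (pre P ts) μ = pre P (ts ⟨ μ ⟩ᵛ)
inst n (φ ∧ᶠ ψ) μ   = inst n φ μ ∧ᶠ inst n ψ μ
inst n (φ ∨ᶠ ψ) μ   = inst n φ μ ∨ᶠ inst n ψ μ
inst n (φ →ᶠ ψ) μ   = inst n φ μ →ᶠ inst n ψ μ
inst n (¬ᶠ φ) μ     = ¬ᶠ inst n φ μ
inst n (∘ᶠ φ) μ     = ∘ᶠ inst n φ μ
inst n (∀ᶠ x φ) μ   = ∀ᶠ n (inst (suc n) φ (μ [ x ↦ var n ]))
inst n (∃ᶠ x φ) μ   = ∃ᶠ n (inst (suc n) φ (μ [ x ↦ var n ]))

⟨⟩-cong  : ∀ {μ ν : Subst Ω} → μ ≗ ν → ∀ t → t ⟨ μ ⟩ ≡ t ⟨ ν ⟩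
⟨⟩ᵛ-cong : ∀ {μ ν : Subst Ω} → μ ≗ ν → ∀ {n} (ts : Vec _ n) → ts ⟨ μ ⟩ᵛ ≡ ts ⟨ ν ⟩ᵛ

⟨⟩-cong μ≗ν (var x)    = μ≗ν x
⟨⟩-cong μ≗ν (con c)    = refl
⟨⟩-cong μ≗ν (fun f ts) = cong (fun f) (⟨⟩ᵛ-cong μ≗ν ts)

⟨⟩ᵛ-cong μ≗ν []       = refl
⟨⟩ᵛ-cong μ≗ν (t ∷ ts) = cong₂ _∷_ (⟨⟩-cong μ≗ν t) (⟨⟩ᵛ-cong μ≗ν ts)

inst-cong : ∀ n (φ : For Ω) {μ ν} → μ ≗ ν → inst n φ μ ≡ inst n φ ν
inst-cong n (pre P ts) μ≗ν = cong (pre P) (⟨⟩ᵛ-cong μ≗ν ts)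
inst-cong n (φ ∧ᶠ ψ) μ≗ν   = cong₂ _∧ᶠ_ (inst-cong n φ μ≗ν) (inst-cong n ψ μ≗ν)
inst-cong n (φ ∨ᶠ ψ) μ≗ν   = cong₂ _∨ᶠ_ (inst-cong n φ μ≗ν) (inst-cong n ψ μ≗ν)
inst-cong n (φ →ᶠ ψ) μ≗ν   = cong₂ _→ᶠ_ (inst-cong n φ μ≗ν) (inst-cong n ψ μ≗ν)
inst-cong n (¬ᶠ φ) μ≗ν     = cong ¬ᶠ_ (inst-cong n φ μ≗ν)
inst-cong n (∘ᶠ φ) μ≗ν     = cong ∘ᶠ_ (inst-cong n φ μ≗ν)
inst-cong n (∀ᶠ x φ) μ≗ν   = cong (∀ᶠ n) (inst-cong (suc n) φ (↦-cong μ≗ν))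
inst-cong n (∃ᶠ x φ) μ≗ν   = cong (∃ᶠ n) (inst-cong (suc n) φ (↦-cong μ≗ν))

substTerm-⟨⟩ : ∀ z (t : Term Ω) μ s → substTerm z t (s ⟨ μ ⟩) ≡ s ⟨ substTerm z t ∘ μ ⟩
substVec-⟨⟩  : ∀ z (t : Term Ω) μ {n} (ss : Vec _ n) →
  substVec z t (ss ⟨ μ ⟩ᵛ) ≡ ss ⟨ substTerm z t ∘ μ ⟩ᵛ

substTerm-⟨⟩ z t μ (var x)    = refl
substTerm-⟨⟩ z t μ (con c)    = refl
substTerm-⟨⟩ z t μ (fun f ss) = cong (fun f) (substVec-⟨⟩ z t μ ss)

substVec-⟨⟩ z t μ []       = refl
substVec-⟨⟩ z t μ (s ∷ ss) = cong₂ _∷_ (substTerm-⟨⟩ z t μ s) (substVec-⟨⟩ z t μ ss)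

substTerm-hit : ∀ x (t : Term Ω) → substTerm x t (var x) ≡ t
substTerm-hit x t with x ≟ x
... | yes _  = refl
... | no x≢x = contradiction refl x≢x

substTerm-miss : ∀ {x y} (t : Term Ω) → y ≢ x → substTerm x t (var y) ≡ var y
substTerm-miss {x = x} {y} t y≢x with y ≟ x
... | yes y≡x = contradiction y≡x y≢x
... | no _    = refl

substTerm-fresh : ∀ x (t s : Term Ω) → ¬ OccursIn x s → substTerm x t s ≡ s
substVec-fresh  : ∀ x (t : Term Ω) {n} (ss : Vec _ n) → ¬ OccursInVec x ss → substVec x t ss ≡ ss

substTerm-fresh x t (var y) x∉s    = substTerm-miss t λ { refl → x∉s var }
substTerm-fresh x t (con c) x∉s    = refl
substTerm-fresh x t (fun f ss) x∉s = cong (fun f) (substVec-fresh x t ss (x∉s ∘ fun))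

substVec-fresh x t [] x∉ss       = refl
substVec-fresh x t (s ∷ ss) x∉ss =
  cong₂ _∷_ (substTerm-fresh x t s (x∉ss ∘ here)) (substVec-fresh x t ss (x∉ss ∘ there))

substTerm-id : ∀ x (s : Term Ω) → substTerm x (var x) s ≡ s
substVec-id  : ∀ x {n} (ss : Vec (Term Ω) n) → substVec x (var x) ss ≡ ss

substTerm-id x (var y) with y ≟ x
... | yes refl = refl
... | no _     = refl
substTerm-id x (con c)    = refl
substTerm-id x (fun f ss) = cong (fun f) (substVec-id x ss)

substVec-id x []       = refl
substVec-id x (s ∷ ss) = cong₂ _∷_ (substTerm-id x s) (substVec-id x ss)

subst-id : ∀ x (φ : For Ω) → φ [ x / var x ] ≡ φ
subst-id x (pre P ts) = cong (pre P) (substVec-id x ts)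
subst-id x (φ ∧ᶠ ψ)   = cong₂ _∧ᶠ_ (subst-id x φ) (subst-id x ψ)
subst-id x (φ ∨ᶠ ψ)   = cong₂ _∨ᶠ_ (subst-id x φ) (subst-id x ψ)
subst-id x (φ →ᶠ ψ)   = cong₂ _→ᶠ_ (subst-id x φ) (subst-id x ψ)
subst-id x (¬ᶠ φ)     = cong ¬ᶠ_ (subst-id x φ)
subst-id x (∘ᶠ φ)     = cong ∘ᶠ_ (subst-id x φ)
subst-id x (∀ᶠ y φ) with y ≟ x
... | yes _ = refl
... | no  _ = cong (∀ᶠ y) (subst-id x φ)
subst-id x (∃ᶠ y φ) with y ≟ x
... | yes _ = refl
... | no  _ = cong (∃ᶠ y) (subst-id x φ)

freeFor-self : ∀ x (φ : For Ω) → FreeFor (var x) x φ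
freeFor-self x (pre P ts) = _
freeFor-self x (φ ∧ᶠ ψ)   = freeFor-self x φ , freeFor-self x ψ
freeFor-self x (φ ∨ᶠ ψ)   = freeFor-self x φ , freeFor-self x ψ
freeFor-self x (φ →ᶠ ψ)   = freeFor-self x φ , freeFor-self x ψ
freeFor-self x (¬ᶠ φ)     = freeFor-self x φ
freeFor-self x (∘ᶠ φ)     = freeFor-self x φ
freeFor-self x (∀ᶠ y φ) with x ≟ y
... | yes x≡y = inj₁ λ (x≢y , _) → x≢y x≡y
... | no x≢y  = inj₂ ((λ { var → x≢y refl }) , freeFor-self x φ)
freeFor-self x (∃ᶠ y φ) with x ≟ y
... | yes x≡y = inj₁ λ (x≢y , _) → x≢y x≡y
... | no x≢y  = inj₂ ((λ { var → x≢y refl }) , freeFor-self x φ)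

-- Variable bounds, freshness and absence of capture

Below : ℕ → Term Ω → Set
Below n t = ∀ {x} → OccursIn x t → x < n

-- The bound covers the values at all variables, not just at those free in a given formula, so no
-- set of free variables has to be tracked.
Bounded : ℕ → Subst Ω → Set
Bounded n μ = ∀ y → Below n (μ y)

below-suc : ∀ {n} {t : Term Ω} → Below n t → Below (suc n) t
below-suc t<n = ℕ.m<n⇒m<1+n ∘ t<n

below-mono : ∀ {m n} {t : Term Ω} → m ≤ⁿ n → Below m t → Below n t
below-mono m≤n t<m x∈t = ℕ.≤-trans (t<m x∈t) m≤n

below-var : ∀ {n x} → x < n → Below {Ω} n (var x)
below-var x<n var = x<n

bounded-↦ : ∀ {n} {μ : Subst Ω} x {t} → Bounded n μ → Below n t → Bounded n (μ [ x ↦ t ])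
bounded-↦ x μ<n t<n y with y ≟ x
... | yes _ = t<n
... | no  _ = μ<n y

bounded-mono : ∀ {m n} {μ : Subst Ω} → m ≤ⁿ n → Bounded m μ → Bounded n μ
bounded-mono m≤n μ<m y = below-mono m≤n (μ<m y)

bounded-bind : ∀ {n} {μ : Subst Ω} x → Bounded n μ → Bounded (suc n) (μ [ x ↦ var n ])
bounded-bind x μ<n = bounded-↦ x (λ y → below-suc (μ<n y)) (below-var ℕ.≤-refl)

fresh : ∀ {n} {μ : Subst Ω} → Bounded n μ → ∀ y → ¬ OccursIn n (μ y)
fresh μ<n y n∈ = ℕ.<-irrefl refl (μ<n y n∈)

occursIn-⟨⟩  : ∀ {x} {μ : Subst Ω} t → OccursIn x (t ⟨ μ ⟩) →
  ∃ λ y → OccursIn y t × OccursIn x (μ y)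
occursIn-⟨⟩ᵛ : ∀ {x} {μ : Subst Ω} {n} (ts : Vec _ n) → OccursInVec x (ts ⟨ μ ⟩ᵛ) →
  ∃ λ y → OccursInVec y ts × OccursIn x (μ y)

occursIn-⟨⟩ (var y) x∈          = y , var , x∈
occursIn-⟨⟩ (fun f ts) (fun x∈) = let y , y∈ , x∈μy = occursIn-⟨⟩ᵛ ts x∈ in y , fun y∈ , x∈μy

occursIn-⟨⟩ᵛ (t ∷ ts) (here x∈)  = let y , y∈ , x∈μy = occursIn-⟨⟩ t x∈ in y , here y∈ , x∈μy
occursIn-⟨⟩ᵛ (t ∷ ts) (there x∈) = let y , y∈ , x∈μy = occursIn-⟨⟩ᵛ ts x∈ in y , there y∈ , x∈μy

freeIn-inst : ∀ {x} n (φ : For Ω) {μ} → FreeIn x (inst n φ μ) →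
  ∃ λ y → FreeIn y φ × OccursIn x (μ y)
freeIn-bind : ∀ {x} n z (φ : For Ω) {μ} → x ≢ n → FreeIn x (inst (suc n) φ (μ [ z ↦ var n ])) →
  ∃ λ y → (y ≢ z × FreeIn y φ) × OccursIn x (μ y)

freeIn-inst n (pre P ts) x∈     = occursIn-⟨⟩ᵛ ts x∈
freeIn-inst n (φ ∧ᶠ ψ) (inj₁ x∈) = let y , y∈ , x∈μy = freeIn-inst n φ x∈ in y , inj₁ y∈ , x∈μy
freeIn-inst n (φ ∧ᶠ ψ) (inj₂ x∈) = let y , y∈ , x∈μy = freeIn-inst n ψ x∈ in y , inj₂ y∈ , x∈μy
freeIn-inst n (φ ∨ᶠ ψ) (inj₁ x∈) = let y , y∈ , x∈μy = freeIn-inst n φ x∈ in y , inj₁ y∈ , x∈μy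
freeIn-inst n (φ ∨ᶠ ψ) (inj₂ x∈) = let y , y∈ , x∈μy = freeIn-inst n ψ x∈ in y , inj₂ y∈ , x∈μy
freeIn-inst n (φ →ᶠ ψ) (inj₁ x∈) = let y , y∈ , x∈μy = freeIn-inst n φ x∈ in y , inj₁ y∈ , x∈μy
freeIn-inst n (φ →ᶠ ψ) (inj₂ x∈) = let y , y∈ , x∈μy = freeIn-inst n ψ x∈ in y , inj₂ y∈ , x∈μy
freeIn-inst n (¬ᶠ φ) x∈          = freeIn-inst n φ x∈
freeIn-inst n (∘ᶠ φ) x∈          = freeIn-inst n φ x∈
freeIn-inst n (∀ᶠ z φ) (x≢n , x∈) = freeIn-bind n z φ x≢n x∈
freeIn-inst n (∃ᶠ z φ) (x≢n , x∈) = freeIn-bind n z φ x≢n x∈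

freeIn-bind n z φ x≢n x∈ with freeIn-inst (suc n) φ x∈
... | y , y∈φ , x∈μy with y ≟ z | x∈μy
...   | yes _  | var   = contradiction refl x≢n
...   | no y≢z | x∈μy′ = y , (y≢z , y∈φ) , x∈μy′

notFreeIn-inst : ∀ {m} n (φ : For Ω) {μ} → Bounded m μ → ¬ FreeIn m (inst n φ μ)
notFreeIn-inst n φ μ<m m∈ = let y , _ , m∈μy = freeIn-inst n φ m∈ in fresh μ<m y m∈μy

-- Every binder of the instance is at least `n`, so it differs from `z` and literal substitution
-- always passes under it.
subst-inst : ∀ {z} (t : Term Ω) n (φ : For Ω) {μ} → z < n →
  inst n φ μ [ z / t ] ≡ inst n φ (substTerm z t ∘ μ)
subst-bind : ∀ {z} (t : Term Ω) n x (φ : For Ω) {μ} → z < n →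
  inst (suc n) φ (μ [ x ↦ var n ]) [ z / t ] ≡
  inst (suc n) φ ((substTerm z t ∘ μ) [ x ↦ var n ])

subst-inst t n (pre P ts) z<n = cong (pre P) (substVec-⟨⟩ _ t _ ts)
subst-inst t n (φ ∧ᶠ ψ) z<n   = cong₂ _∧ᶠ_ (subst-inst t n φ z<n) (subst-inst t n ψ z<n)
subst-inst t n (φ ∨ᶠ ψ) z<n   = cong₂ _∨ᶠ_ (subst-inst t n φ z<n) (subst-inst t n ψ z<n)
subst-inst t n (φ →ᶠ ψ) z<n   = cong₂ _→ᶠ_ (subst-inst t n φ z<n) (subst-inst t n ψ z<n)
subst-inst t n (¬ᶠ φ) z<n     = cong ¬ᶠ_ (subst-inst t n φ z<n)
subst-inst t n (∘ᶠ φ) z<n     = cong ∘ᶠ_ (subst-inst t n φ z<n)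
subst-inst {z = z} t n (∀ᶠ x φ) z<n with n ≟ z
... | yes refl = contradiction z<n (ℕ.<-irrefl refl)
... | no _     = cong (∀ᶠ n) (subst-bind t n x φ z<n)
subst-inst {z = z} t n (∃ᶠ x φ) z<n with n ≟ z
... | yes refl = contradiction z<n (ℕ.<-irrefl refl)
... | no _     = cong (∃ᶠ n) (subst-bind t n x φ z<n)

subst-bind {z = z} t n x φ {μ} z<n =
  ≡.trans (subst-inst t (suc n) φ (ℕ.m<n⇒m<1+n z<n)) (inst-cong (suc n) φ commute)
  where
  commute : substTerm z t ∘ (μ [ x ↦ var n ]) ≗ (substTerm z t ∘ μ) [ x ↦ var n ]
  commute y with y ≟ x
  ... | yes _ = substTerm-miss t λ { refl → ℕ.<-irrefl refl z<n }
  ... | no  _ = refl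

freeFor-inst : ∀ {t : Term Ω} z n (φ : For Ω) {μ} → Below n t → FreeFor t z (inst n φ μ)
freeFor-inst z n (pre P ts) t<n = _
freeFor-inst z n (φ ∧ᶠ ψ) t<n   = freeFor-inst z n φ t<n , freeFor-inst z n ψ t<n
freeFor-inst z n (φ ∨ᶠ ψ) t<n   = freeFor-inst z n φ t<n , freeFor-inst z n ψ t<n
freeFor-inst z n (φ →ᶠ ψ) t<n   = freeFor-inst z n φ t<n , freeFor-inst z n ψ t<n
freeFor-inst z n (¬ᶠ φ) t<n     = freeFor-inst z n φ t<n
freeFor-inst z n (∘ᶠ φ) t<n     = freeFor-inst z n φ t<n
freeFor-inst z n (∀ᶠ x φ) t<n   =
  inj₂ ((λ n∈t → ℕ.<-irrefl refl (t<n n∈t)) , freeFor-inst z (suc n) φ (below-suc t<n))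
freeFor-inst z n (∃ᶠ x φ) t<n   =
  inj₂ ((λ n∈t → ℕ.<-irrefl refl (t<n n∈t)) , freeFor-inst z (suc n) φ (below-suc t<n))

-- Quantifier laws and change of bound variables

≡⇒≼ : ∀ {α β : For Ω} → α ≡ β → α ≼ β
≡⇒≼ refl = ≼-refl

∀-elim : ∀ {φ : For Ω} {x} → ∀ᶠ x φ ≼ φ
∀-elim {φ = φ} {x} = ≼-trans (⊢-axiom (ax∀ φ x (var x) (freeFor-self x φ))) (≡⇒≼ (subst-id x φ))

∃-intro : ∀ {φ : For Ω} {x} → φ ≼ ∃ᶠ x φ
∃-intro {φ = φ} {x} =
  ≼-trans (≡⇒≼ (≡.sym (subst-id x φ))) (⊢-axiom (ax∃ φ x (var x) (freeFor-self x φ)))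

∀-mono : ∀ {φ ψ : For Ω} {x} → φ ≼ ψ → ∀ᶠ x φ ≼ ∀ᶠ x ψ
∀-mono φ≼ψ = ⊢-∀-in (λ (x≢x , _) → x≢x refl) (≼-trans ∀-elim φ≼ψ)

∃-mono : ∀ {φ ψ : For Ω} {x} → φ ≼ ψ → ∃ᶠ x φ ≼ ∃ᶠ x ψ
∃-mono φ≼ψ = ⊢-∃-in (λ (x≢x , _) → x≢x refl) (≼-trans φ≼ψ ∃-intro)

∀-inst : ∀ {z k} {t : Term Ω} (φ : For Ω) {μ} → z < k → Below k t →
  ∀ᶠ z (inst k φ μ) ≼ inst k φ (substTerm z t ∘ μ)
∀-inst {k = k} {t} φ z<k t<k =
  ≼-trans (⊢-axiom (ax∀ _ _ t (freeFor-inst _ k φ t<k))) (≡⇒≼ (subst-inst t k φ z<k))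

∃-inst : ∀ {z k} {t : Term Ω} (φ : For Ω) {μ} → z < k → Below k t →
  inst k φ (substTerm z t ∘ μ) ≼ ∃ᶠ z (inst k φ μ)
∃-inst {k = k} {t} φ z<k t<k =
  ≼-trans (≡⇒≼ (≡.sym (subst-inst t k φ z<k))) (⊢-axiom (ax∃ _ _ t (freeFor-inst _ k φ t<k)))

substTerm-bind : ∀ {n} {μ : Subst Ω} x t → Bounded n μ →
  substTerm n t ∘ (μ [ x ↦ var n ]) ≗ μ [ x ↦ t ]
substTerm-bind x t μ<n y with y ≟ x
... | yes _ = substTerm-hit _ t
... | no  _ = substTerm-fresh _ t _ (fresh μ<n y)

-- Simultaneous induction on the formula with the next two: renaming a quantifier eliminates it at
-- the new variable, and eliminating it renames inside its body.
inst-rename : ∀ {m n} (φ : For Ω) {μ} → Bounded m μ → Bounded n μ → inst m φ μ ≼ inst n φ μ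
inst-∀-elim : ∀ {m n} x t (φ : For Ω) {μ} → Bounded m μ → Bounded n μ → Below n t →
  inst m (∀ᶠ x φ) μ ≼ inst n φ (μ [ x ↦ t ])
inst-∃-intro : ∀ {m n} x t (φ : For Ω) {μ} → Bounded m μ → Bounded n μ → Below n t →
  inst n φ (μ [ x ↦ t ]) ≼ inst m (∃ᶠ x φ) μ

inst-rename (pre P ts) μ<m μ<n = ≼-refl
inst-rename (φ ∧ᶠ ψ) μ<m μ<n   = ∧ᶠ-mono (inst-rename φ μ<m μ<n) (inst-rename ψ μ<m μ<n)
inst-rename (φ ∨ᶠ ψ) μ<m μ<n   = ∨ᶠ-mono (inst-rename φ μ<m μ<n) (inst-rename ψ μ<m μ<n)
inst-rename (φ →ᶠ ψ) μ<m μ<n   = →ᶠ-mono (inst-rename φ μ<n μ<m) (inst-rename ψ μ<m μ<n)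
inst-rename (¬ᶠ φ) μ<m μ<n     = ¬ᶠ-mono (inst-rename φ μ<m μ<n) (inst-rename φ μ<n μ<m)
inst-rename (∘ᶠ φ) μ<m μ<n     = ∘ᶠ-mono (inst-rename φ μ<m μ<n) (inst-rename φ μ<n μ<m)
-- The hidden term is `var n`, the new binder, with counter `suc n` for the body; as `n` occurs in
-- no value of `μ`, it is not free in the left formula.
inst-rename (∀ᶠ x φ) μ<m μ<n   = ⊢-∀-in (notFreeIn-inst _ (∀ᶠ x φ) μ<n)
  (inst-∀-elim x (var _) φ μ<m (bounded-mono (ℕ.m≤n⇒m≤1+n ℕ.≤-refl) μ<n) (below-var ℕ.≤-refl))
inst-rename (∃ᶠ x φ) μ<m μ<n   = ⊢-∃-in (notFreeIn-inst _ (∃ᶠ x φ) μ<m)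
  (inst-∃-intro x (var _) φ μ<n (bounded-mono (ℕ.m≤n⇒m≤1+n ℕ.≤-refl) μ<m) (below-var ℕ.≤-refl))

-- The bound variables are first renamed to at least k, above all variables
-- in sight, so that t can be substituted literally.
inst-∀-elim {m = m} {n} x t φ {μ} μ<m μ<n t<n =
  ≼-trans (∀-mono (inst-rename φ (bounded-bind x μ<m) (bounded-mono m<k (bounded-bind x μ<m))))
  (≼-trans (∀-inst φ m<k (below-mono n≤k t<n))
  (≼-trans (≡⇒≼ (inst-cong k φ (substTerm-bind x t μ<m)))
           (inst-rename φ (bounded-mono n≤k μt<n) μt<n)))
  where
  k = suc m ⊔ⁿ n
  m<k : m < k
  m<k = ℕ.m≤m⊔n (suc m) n
  n≤k : n ≤ⁿ k
  n≤k = ℕ.m≤n⊔m (suc m) n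
  μt<n : Bounded n (μ [ x ↦ t ])
  μt<n = bounded-↦ x μ<n t<n

inst-∃-intro {m = m} {n} x t φ {μ} μ<m μ<n t<n =
  ≼-trans (inst-rename φ μt<n (bounded-mono n≤k μt<n))
  (≼-trans (≡⇒≼ (≡.sym (inst-cong k φ (substTerm-bind x t μ<m))))
  (≼-trans (∃-inst φ m<k (below-mono n≤k t<n))
           (∃-mono (inst-rename φ (bounded-mono m<k (bounded-bind x μ<m)) (bounded-bind x μ<m)))))
  where
  k = suc m ⊔ⁿ n
  m<k : m < k
  m<k = ℕ.m≤m⊔n (suc m) n
  n≤k : n ≤ⁿ k
  n≤k = ℕ.m≤n⊔m (suc m) n
  μt<n : Bounded n (μ [ x ↦ t ])
  μt<n = bounded-↦ x μ<n t<n

-- A formula and its instance under the cut-off identity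

termBound : Term Ω → ℕ
vecBound  : ∀ {n} → Vec (Term Ω) n → ℕ

termBound (var x)    = suc x
termBound (con c)    = 0
termBound (fun f ts) = vecBound ts

vecBound []       = 0
vecBound (t ∷ ts) = termBound t ⊔ⁿ vecBound ts

-- Bound variables are counted as well, since `clip` must fix them when the recursion goes under
-- their quantifiers.
forBound : For Ω → ℕ
forBound (pre P ts) = vecBound ts
forBound (φ ∧ᶠ ψ)   = forBound φ ⊔ⁿ forBound ψ
forBound (φ ∨ᶠ ψ)   = forBound φ ⊔ⁿ forBound ψ
forBound (φ →ᶠ ψ)   = forBound φ ⊔ⁿ forBound ψ
forBound (¬ᶠ φ)     = forBound φ
forBound (∘ᶠ φ)     = forBound φ
forBound (∀ᶠ x φ)   = suc x ⊔ⁿ forBound φ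
forBound (∃ᶠ x φ)   = suc x ⊔ⁿ forBound φ

termBound-below : ∀ (t : Term Ω) → Below (termBound t) t
vecBound-below  : ∀ {n} (ts : Vec (Term Ω) n) {x} → OccursInVec x ts → x < vecBound ts

termBound-below (var x) var         = ℕ.≤-refl
termBound-below (fun f ts) (fun x∈) = vecBound-below ts x∈

vecBound-below (t ∷ ts) (here x∈)  = ℕ.m<n⇒m<n⊔o _ (termBound-below t x∈)
vecBound-below (t ∷ ts) (there x∈) = ℕ.m<n⇒m<o⊔n _ (vecBound-below ts x∈)

forBound-free : ∀ {x} (φ : For Ω) → FreeIn x φ → x < forBound φ
forBound-free (pre P ts) x∈       = vecBound-below ts x∈
forBound-free (φ ∧ᶠ ψ) (inj₁ x∈)  = ℕ.m<n⇒m<n⊔o _ (forBound-free φ x∈)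
forBound-free (φ ∧ᶠ ψ) (inj₂ x∈)  = ℕ.m<n⇒m<o⊔n _ (forBound-free ψ x∈)
forBound-free (φ ∨ᶠ ψ) (inj₁ x∈)  = ℕ.m<n⇒m<n⊔o _ (forBound-free φ x∈)
forBound-free (φ ∨ᶠ ψ) (inj₂ x∈)  = ℕ.m<n⇒m<o⊔n _ (forBound-free ψ x∈)
forBound-free (φ →ᶠ ψ) (inj₁ x∈)  = ℕ.m<n⇒m<n⊔o _ (forBound-free φ x∈)
forBound-free (φ →ᶠ ψ) (inj₂ x∈)  = ℕ.m<n⇒m<o⊔n _ (forBound-free ψ x∈)
forBound-free (¬ᶠ φ) x∈           = forBound-free φ x∈
forBound-free (∘ᶠ φ) x∈           = forBound-free φ x∈
forBound-free (∀ᶠ y φ) (_ , x∈)   = ℕ.m<n⇒m<o⊔n _ (forBound-free φ x∈)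
forBound-free (∃ᶠ y φ) (_ , x∈)   = ℕ.m<n⇒m<o⊔n _ (forBound-free φ x∈)

forBound-fresh : ∀ {m} (φ : For Ω) → forBound φ ≤ⁿ m → ¬ FreeIn m φ
forBound-fresh φ φ≤m m∈φ = ℕ.<-irrefl refl (ℕ.≤-trans (forBound-free φ m∈φ) φ≤m)

-- The identity below N, cut off so that it is Bounded.
clip : ℕ → Subst Ω
clip N y = var (y ⊓ⁿ N)

clip-below : ∀ {N y} → y < N → clip {Ω} N y ≡ var y
clip-below y<N = cong var (ℕ.m≤n⇒m⊓n≡m (ℕ.<⇒≤ y<N))

clip-separates : ∀ {N x} y → x < N → y ≢ x → y ⊓ⁿ N ≢ x
clip-separates {N} y x<N y≢x y⊓N≡x with ℕ.⊓-sel y N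
... | inj₁ y⊓N≡y = y≢x (≡.trans (≡.sym y⊓N≡y) y⊓N≡x)
... | inj₂ y⊓N≡N = ℕ.<-irrefl (≡.trans (≡.sym y⊓N≡x) y⊓N≡N) x<N

-- The inequality is strict because `var N` is itself a value of `clip N`.
clip-bounded : ∀ {N n} → N < n → Bounded {Ω} n (clip N)
clip-bounded {N = N} N<n y var = ℕ.≤-trans (s≤s (ℕ.m⊓n≤n y N)) N<n

clip-restore : ∀ {N x} → x < N → clip {Ω} N [ x ↦ var x ] ≗ clip N
clip-restore {x = x} x<N y with y ≟ x
... | yes refl = ≡.sym (clip-below x<N)
... | no _     = refl

clip-subst : ∀ {N x n} → x < N → substTerm {Ω} x (var n) ∘ clip N ≗ clip N [ x ↦ var n ]
clip-subst {N = N} {x} {n} x<N y with y ≟ x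
... | yes refl = ≡.trans (cong (substTerm x (var n)) (clip-below x<N)) (substTerm-hit x _)
... | no y≢x   = substTerm-miss _ (clip-separates y x<N y≢x)

-- For `x < N`, only `x` is sent to `var x` by `clip N`, and there the quantifier puts `var n`
-- instead.
clip-bind-fresh : ∀ {N x} n (φ : For Ω) → x < N → ¬ FreeIn x (inst n (∀ᶠ x φ) (clip N))
clip-bind-fresh n φ x<N (x≢n , x∈) with freeIn-bind n _ φ x≢n x∈
... | y , (y≢x , _) , var = clip-separates y x<N y≢x refl

⟨clip⟩  : ∀ {N} (t : Term Ω) → termBound t ≤ⁿ N → t ⟨ clip N ⟩ ≡ t
⟨clip⟩ᵛ : ∀ {N n} (ts : Vec (Term Ω) n) → vecBound ts ≤ⁿ N → ts ⟨ clip N ⟩ᵛ ≡ ts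

⟨clip⟩ (var x) x<N      = clip-below x<N
⟨clip⟩ (con c) _        = refl
⟨clip⟩ (fun f ts) ts≤N  = cong (fun f) (⟨clip⟩ᵛ ts ts≤N)

⟨clip⟩ᵛ [] _ = refl
⟨clip⟩ᵛ (t ∷ ts) ≤N =
  cong₂ _∷_ (⟨clip⟩ t (ℕ.m⊔n≤o⇒m≤o _ _ ≤N)) (⟨clip⟩ᵛ ts (ℕ.m⊔n≤o⇒n≤o (termBound t) _ ≤N))

-- Proved together with its converse: implication reverses direction, and `¬ᶠ` and `∘ᶠ` respect only
-- equivalences. `N` stays fixed while the counter grows.
≼inst-clip : ∀ {N n} (φ : For Ω) → forBound φ ≤ⁿ N → N < n → φ ≼ inst n φ (clip N)
inst-clip≼ : ∀ {N n} (φ : For Ω) → forBound φ ≤ⁿ N → N < n → inst n φ (clip N) ≼ φ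

≼inst-clip (pre P ts) ≤N N<n = ≡⇒≼ (cong (pre P) (≡.sym (⟨clip⟩ᵛ ts ≤N)))
≼inst-clip (φ ∧ᶠ ψ) ≤N N<n =
  ∧ᶠ-mono (≼inst-clip φ (ℕ.m⊔n≤o⇒m≤o _ _ ≤N) N<n) (≼inst-clip ψ (ℕ.m⊔n≤o⇒n≤o (forBound φ) _ ≤N) N<n)
≼inst-clip (φ ∨ᶠ ψ) ≤N N<n =
  ∨ᶠ-mono (≼inst-clip φ (ℕ.m⊔n≤o⇒m≤o _ _ ≤N) N<n) (≼inst-clip ψ (ℕ.m⊔n≤o⇒n≤o (forBound φ) _ ≤N) N<n)
≼inst-clip (φ →ᶠ ψ) ≤N N<n =
  →ᶠ-mono (inst-clip≼ φ (ℕ.m⊔n≤o⇒m≤o _ _ ≤N) N<n) (≼inst-clip ψ (ℕ.m⊔n≤o⇒n≤o (forBound φ) _ ≤N) N<n)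
≼inst-clip (¬ᶠ φ) ≤N N<n = ¬ᶠ-mono (≼inst-clip φ ≤N N<n) (inst-clip≼ φ ≤N N<n)
≼inst-clip (∘ᶠ φ) ≤N N<n = ∘ᶠ-mono (≼inst-clip φ ≤N N<n) (inst-clip≼ φ ≤N N<n)
≼inst-clip {n = n} (∀ᶠ x φ) ≤N N<n =
  ⊢-∀-in (forBound-fresh (∀ᶠ x φ) (ℕ.≤-trans ≤N (ℕ.<⇒≤ N<n)))
    -- Under the original binder `x` the counter is already `suc n`, so `var n` can then replace `x`
    -- literally.
    (≼-trans (∀-mono (≼inst-clip φ (ℕ.m⊔n≤o⇒n≤o (suc x) _ ≤N) (ℕ.m<n⇒m<1+n N<n)))
    (≼-trans (∀-inst φ (ℕ.<-trans x<N (ℕ.m<n⇒m<1+n N<n)) (below-var ℕ.≤-refl))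
             (≡⇒≼ (inst-cong (suc n) φ (clip-subst x<N)))))
  where x<N = ℕ.m⊔n≤o⇒m≤o (suc x) (forBound φ) ≤N
≼inst-clip (∃ᶠ x φ) ≤N N<n =
  ⊢-∃-in (clip-bind-fresh _ φ x<N)
    (≼-trans (≼inst-clip φ (ℕ.m⊔n≤o⇒n≤o (suc x) _ ≤N) N<n)
    (≼-trans (≡⇒≼ (≡.sym (inst-cong _ φ (clip-restore x<N))))
             (inst-∃-intro x (var x) φ (clip-bounded N<n) (clip-bounded N<n)
               (below-var (ℕ.<-trans x<N N<n)))))
  where x<N = ℕ.m⊔n≤o⇒m≤o (suc x) (forBound φ) ≤N

inst-clip≼ (pre P ts) ≤N N<n = ≡⇒≼ (cong (pre P) (⟨clip⟩ᵛ ts ≤N))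
inst-clip≼ (φ ∧ᶠ ψ) ≤N N<n =
  ∧ᶠ-mono (inst-clip≼ φ (ℕ.m⊔n≤o⇒m≤o _ _ ≤N) N<n) (inst-clip≼ ψ (ℕ.m⊔n≤o⇒n≤o (forBound φ) _ ≤N) N<n)
inst-clip≼ (φ ∨ᶠ ψ) ≤N N<n =
  ∨ᶠ-mono (inst-clip≼ φ (ℕ.m⊔n≤o⇒m≤o _ _ ≤N) N<n) (inst-clip≼ ψ (ℕ.m⊔n≤o⇒n≤o (forBound φ) _ ≤N) N<n)
inst-clip≼ (φ →ᶠ ψ) ≤N N<n =
  →ᶠ-mono (≼inst-clip φ (ℕ.m⊔n≤o⇒m≤o _ _ ≤N) N<n) (inst-clip≼ ψ (ℕ.m⊔n≤o⇒n≤o (forBound φ) _ ≤N) N<n)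
inst-clip≼ (¬ᶠ φ) ≤N N<n = ¬ᶠ-mono (inst-clip≼ φ ≤N N<n) (≼inst-clip φ ≤N N<n)
inst-clip≼ (∘ᶠ φ) ≤N N<n = ∘ᶠ-mono (inst-clip≼ φ ≤N N<n) (≼inst-clip φ ≤N N<n)
inst-clip≼ (∀ᶠ x φ) ≤N N<n =
  ⊢-∀-in (clip-bind-fresh _ φ x<N)
    (≼-trans (inst-∀-elim x (var x) φ (clip-bounded N<n) (clip-bounded N<n)
               (below-var (ℕ.<-trans x<N N<n)))
    (≼-trans (≡⇒≼ (inst-cong _ φ (clip-restore x<N)))
             (inst-clip≼ φ (ℕ.m⊔n≤o⇒n≤o (suc x) _ ≤N) N<n)))
  where x<N = ℕ.m⊔n≤o⇒m≤o (suc x) (forBound φ) ≤N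
inst-clip≼ {n = n} (∃ᶠ x φ) ≤N N<n =
  ⊢-∃-in (forBound-fresh (∃ᶠ x φ) (ℕ.≤-trans ≤N (ℕ.<⇒≤ N<n)))
    (≼-trans (≡⇒≼ (≡.sym (inst-cong (suc n) φ (clip-subst x<N))))
    (≼-trans (∃-inst φ (ℕ.<-trans x<N (ℕ.m<n⇒m<1+n N<n)) (below-var ℕ.≤-refl))
             (∃-mono (inst-clip≼ φ (ℕ.m⊔n≤o⇒n≤o (suc x) _ ≤N) (ℕ.m<n⇒m<1+n N<n)))))
  where x<N = ℕ.m⊔n≤o⇒m≤o (suc x) (forBound φ) ≤N

-- One instance suffices: at a variable `w` that is fresh for `β` and at least `n`, ∀-In applies,
-- and the binder `w` is then renamed to `n`. The counters `k t` may vary with the term.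
inst-∀-greatest : ∀ {n} x (φ β : For Ω) {μ} {k : Term Ω → ℕ} → Bounded n μ →
  (∀ t → Bounded (k t) (μ [ x ↦ t ])) →
  (∀ t → β ≼ inst (k t) φ (μ [ x ↦ t ])) → β ≼ inst n (∀ᶠ x φ) μ
inst-∀-greatest {n = n} x φ β μ<n μt<k β≼ = ≼-trans
  (⊢-∀-in (forBound-fresh β (ℕ.m≤m⊔n _ n))
    (≼-trans (β≼ (var w)) (inst-rename φ (μt<k (var w)) (bounded-bind x μ<w))))
  (inst-rename (∀ᶠ x φ) μ<w μ<n)
  where
  w = forBound β ⊔ⁿ n
  μ<w = bounded-mono (ℕ.m≤n⊔m (forBound β) n) μ<n

inst-∃-least : ∀ {n} x (φ β : For Ω) {μ} {k : Term Ω → ℕ} → Bounded n μ →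
  (∀ t → Bounded (k t) (μ [ x ↦ t ])) →
  (∀ t → inst (k t) φ (μ [ x ↦ t ]) ≼ β) → inst n (∃ᶠ x φ) μ ≼ β
inst-∃-least {n = n} x φ β μ<n μt<k ≼β = ≼-trans
  (inst-rename (∃ᶠ x φ) μ<n μ<w)
  (⊢-∃-in (forBound-fresh β (ℕ.m≤m⊔n _ n))
    (≼-trans (inst-rename φ (bounded-bind x μ<w) (μt<k (var w))) (≼β (var w))))
  where
  w = forBound β ⊔ⁿ n
  μ<w = bounded-mono (ℕ.m≤n⊔m (forBound β) n) μ<n

-- The canonical structure

module Canonical (Ω : Signature) (ℓ : Level) where
  open Lindenbaum Ω
  open Completion lindenbaum ℓ

  canonical : Structure Ω ℓ
  canonical = record
    { U = Lift ℓ (Term Ω)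
    ; point = lift (var 0)
    ; alg = completion
    ; conᴵ = λ c → lift (con c)
    ; funᴵ = λ f ts → lift (fun f (map lower ts))
    ; preᴵ = λ P ts → principal (pre P (map lower ts))
    }

  open Structure canonical
    using (Assignment; _[_≔_]; ⟦_⟧ᵗ; ⟦_⟧ᵛ; ⟦_⟧; _≈_)
  open BooleanAlgebra (CompleteBALFI.booleanAlgebra completion)
    using (∧-cong; ∨-cong; ¬-cong)
    renaming (sym to ≈-sym; trans to ≈-trans; reflexive to ≈-reflexive)

  ⟦⟧ᵗ≡⟨⟩ : ∀ t μ → lower (⟦ t ⟧ᵗ μ) ≡ t ⟨ lower ∘ μ ⟩
  ⟦⟧ᵛ≡⟨⟩ : ∀ {n} (ts : Vec (Term Ω) n) μ → map lower (⟦ ts ⟧ᵛ μ) ≡ ts ⟨ lower ∘ μ ⟩ᵛ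

  ⟦⟧ᵗ≡⟨⟩ (var x) μ    = refl
  ⟦⟧ᵗ≡⟨⟩ (con c) μ    = refl
  ⟦⟧ᵗ≡⟨⟩ (fun f ts) μ = cong (fun f) (⟦⟧ᵛ≡⟨⟩ ts μ)

  ⟦⟧ᵛ≡⟨⟩ [] μ       = refl
  ⟦⟧ᵛ≡⟨⟩ (t ∷ ts) μ = cong₂ _∷_ (⟦⟧ᵗ≡⟨⟩ t μ) (⟦⟧ᵛ≡⟨⟩ ts μ)

  lower-≔ : ∀ (μ : Assignment) x a → lower ∘ (μ [ x ≔ a ]) ≗ (lower ∘ μ) [ x ↦ lower a ]
  lower-≔ μ x a y with y ≟ x
  ... | yes _ = refl
  ... | no  _ = refl

  private
    update-bound : ℕ → Lift ℓ (Term Ω) → ℕ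
    update-bound n a = n ⊔ⁿ termBound (lower a)

    below-update : ∀ n a → Below (update-bound n a) (lower a)
    below-update n a = below-mono (ℕ.m≤n⊔m n _) (termBound-below (lower a))

    bounded-weaken : ∀ {n μ} a → Bounded {Ω} n μ → Bounded (update-bound n a) μ
    bounded-weaken a = bounded-mono (ℕ.m≤m⊔n _ _)

    bounded-update : ∀ {n μ} x a → Bounded {Ω} n μ →
      Bounded (update-bound n a) (μ [ x ↦ lower a ])
    bounded-update x a μ<n = bounded-↦ x (bounded-weaken a μ<n) (below-update _ a)

  -- Every admissible counter `n` is allowed because updating by a term raises the bound; the
  -- quantifier cases compare instances with different counters.
  truth : ∀ φ {n} (μ : Assignment) → Bounded n (lower ∘ μ) →
    ⟦ φ ⟧ μ ≈ principal (inst n φ (lower ∘ μ))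
  truth-update : ∀ φ {n} (μ : Assignment) x a → Bounded n (lower ∘ μ) →
    ⟦ φ ⟧ (μ [ x ≔ a ]) ≈ principal (inst (update-bound n a) φ ((lower ∘ μ) [ x ↦ lower a ]))

  truth (pre P ts) μ μ<n = ≈-reflexive (cong (principal ∘ pre P) (⟦⟧ᵛ≡⟨⟩ ts μ))
  truth (φ ∧ᶠ ψ) μ μ<n = ≈-trans (∧-cong (truth φ μ μ<n) (truth ψ μ μ<n)) (principal-∧ _ _)
  truth (φ ∨ᶠ ψ) μ μ<n = ≈-trans (∨-cong (truth φ μ μ<n) (truth ψ μ μ<n)) (principal-∨ _ _)
  -- Semantic implication is a complement joined with the consequent; Ax9 enters through `→⇒∁∨` to
  -- identify it with `→ᶠ`.
  truth (φ →ᶠ ψ) μ μ<n = ≈-trans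
    (∨-cong (≈-trans (¬-cong (truth φ μ μ<n)) (principal-∁ _)) (truth ψ μ μ<n))
    (≈-trans (principal-∨ _ _) (principal-cong (∁∨⇒→ , →⇒∁∨)))
  truth (¬ᶠ φ) μ μ<n = ≈-trans (¬ᴿ-cong (truth φ μ μ<n)) (principal-¬ _)
  truth (∘ᶠ φ) μ μ<n = ≈-trans (∘ᴿ-cong (truth φ μ μ<n)) (principal-∘ _)
  truth (∀ᶠ x φ) μ μ<n = principal-⋀ (λ a → truth-update φ μ x a μ<n)
    ( (λ a → ≤⇒≤ᵃ (inst-∀-elim x (lower a) φ μ<n (bounded-weaken a μ<n) (below-update _ a)))
    , λ β β≤ → ≤⇒≤ᵃ (inst-∀-greatest x φ β μ<n (λ t → bounded-update x (lift t) μ<n)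
        (λ t → ≤ᵃ⇒≤ (β≤ (lift t)))))
  truth (∃ᶠ x φ) μ μ<n = principal-⋁ (λ a → truth-update φ μ x a μ<n)
    ( (λ a → ≤⇒≤ᵃ (inst-∃-intro x (lower a) φ μ<n (bounded-weaken a μ<n) (below-update _ a)))
    , λ β ≤β → ≤⇒≤ᵃ (inst-∃-least x φ β μ<n (λ t → bounded-update x (lift t) μ<n)
        (λ t → ≤ᵃ⇒≤ (≤β (lift t)))))

  truth-update φ μ x a μ<n = ≈-trans
    (truth φ (μ [ x ≔ a ]) λ y → subst (Below _) (≡.sym (lower-≔ μ x a y)) (bounded-update x a μ<n y))
    (≈-reflexive (cong principal (inst-cong _ φ (lower-≔ μ x a))))

  -- Validity is applied once, in the canonical structure at the cut-off identity. The value `𝟏`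
  -- there is the class of `⊤ᶠ`, so the instance is provable, and with it `φ`.
  valid⇒⊢ : ∀ {φ} → Valid ℓ φ → ⊢ φ
  valid⇒⊢ {φ} ⊨φ = ⊢-mp (inst-clip≼ φ ℕ.≤-refl ℕ.≤-refl) (⊢-mp ⊤≼φ ≼-refl)
    where
    ι : Assignment
    ι = lift ∘ clip (forBound φ)

    ⊤≼φ : ⊤ᶠ ≼ inst (suc (forBound φ)) φ (clip (forBound φ))
    ⊤≼φ = ≤ᵃ⇒≤ (principal-reflects (proj₁ (≈-trans principal-𝟏
      (≈-trans (≈-sym (⊨φ canonical ι)) (truth φ ι (clip-bounded ℕ.≤-refl))))))

theorem7p22 : (Ω : Signature) (ℓ g : Level) (Γ : Pred (For Ω) g) (φ : For Ω) →
    Γ ⊆ Sentence → Sentence φ → Γ ⊨[ ℓ ] φ → Γ ⊢ φ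
theorem7p22 Ω ℓ g Γ φ _ _ (inj₁ ⊨φ)               = inj₁ (Canonical.valid⇒⊢ Ω ℓ ⊨φ)
theorem7p22 Ω ℓ g Γ φ _ _ (inj₂ (γs , γs⊆Γ , ⊨φ)) = inj₂ (γs , γs⊆Γ , Canonical.valid⇒⊢ Ω ℓ ⊨φ)
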